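{- For any $n\ge 5$, $2n+3\le g(n)\le (n+1)2^{\frac{1}{2}n\log_2 n}$.
   Context: A simple game is $(P,W)$ with $P=[n]$, $W\subseteq 2^P$ (winning coalitions) closed under supersets within $P$, $W\ne\emptyset$, $W\ne 2^P$; other coalitions are losing. It is roughly weighted if there exist non-negative reals $w_1,\dots,w_n$ and a real $q$, not all zero, such that $\sum_{i\in X}w_i<q$ implies $X$ losing and $\sum_{i\in X}w_i>q$ implies $X$ winning. A trading transform of length $j$ is $(X_1,\dots,X_j;Y_1,\dots,Y_j)$ with every player in equally many $X_i$'s and $Y_i$'s; it is a certificate of non-weightedness if all $X_i$ are winning and all $Y_i$ losing, and potent if additionally $P$ is among the $X_i$ and $\emptyset$ among the $Y_i$. For a game $G$, $g(G)$ is the length of the shortest potent certificate of non-weightedness ($\infty$ if $G$ is roughly weighted), and $g(n)=\max_G g(G)$ over all non-roughly-weighted simple games $G$ with $n$ players.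
   Formalization: In the definition of a roughly weighted game, the weights and the quota are rational instead of real; the two notions are equivalent because the conditions define a rational polyhedral cone. -}

module Defs where

open import Data.Nat using (ℕ; zero; suc; _+_; _*_; _^_; _≤_)
open import Data.Bool using (Bool; true; false; if_then_else_)
open import Data.Fin using (Fin; zero; suc)
open import Data.Fin.Subset using (Subset; _⊆_; ⊤; ⊥)
open import Data.Vec using (Vec; []; _∷_; lookup)
open import Data.Rational using (ℚ; 0ℚ) renaming (_+_ to _+ℚ_; _<_ to _<ℚ_; _≤_ to _≤ℚ_)
open import Data.Product using (Σ; ∃; _×_; _,_)
open import Relation.Binary.PropositionalEquality using (_≡_)
open import Relation.Nullary using (¬_)
open import Function using (_∘_)

record SimpleGame (n : ℕ) : Set where
  field
    win       : Subset n → Bool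
    monotone  : ∀ X Y → X ⊆ Y → win X ≡ true → win Y ≡ true
    someWin   : ∃ λ X → win X ≡ true
    someLose  : ∃ λ X → win X ≡ false
open SimpleGame public

weight : ∀ {n} → (Fin n → ℚ) → Subset n → ℚ
weight w [] = 0ℚ
weight w (b ∷ X) = (if b then w zero else 0ℚ) +ℚ weight (w ∘ suc) X

RoughlyWeighted : ∀ {n} → SimpleGame n → Set
RoughlyWeighted {n} G =
  Σ (Fin n → ℚ) λ w → Σ ℚ λ q →
    (∀ i → 0ℚ ≤ℚ w i) ×
    ¬ ((∀ i → w i ≡ 0ℚ) × q ≡ 0ℚ) ×
    (∀ X → weight w X <ℚ q → win G X ≡ false) ×
    (∀ X → q <ℚ weight w X → win G X ≡ true)

mult : ∀ {j n} → (Fin j → Subset n) → Fin n → ℕ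
mult {zero}  Xs i = 0
mult {suc j} Xs i = (if lookup (Xs zero) i then 1 else 0) + mult (Xs ∘ suc) i

record TradingTransform (n j : ℕ) : Set where
  field
    xs : Fin j → Subset n
    ys : Fin j → Subset n
    balanced : ∀ i → mult xs i ≡ mult ys i
open TradingTransform public

IsCertificate : ∀ {n j} → SimpleGame n → TradingTransform n j → Set
IsCertificate G T =
  (∀ k → win G (xs T k) ≡ true) × (∀ k → win G (ys T k) ≡ false)

IsPotentCertificate : ∀ {n j} → SimpleGame n → TradingTransform n j → Set
IsPotentCertificate G T =
  IsCertificate G T × (∃ λ k → xs T k ≡ ⊤) × (∃ λ k → ys T k ≡ ⊥)

module Submission where

-- Lower bound.  Give the players 3, 3, 2, 2, 2, 2, … points.  Coalitions with at least 8 points win,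
-- and so do the supersets of {0,1} and of {2,3,4}, which have only 6 points.  Winning coalitions have
-- at least 6 points and losing ones at most 7, so the pair (P, ∅) of a potent certificate, which
-- contributes all 2n+2 points, has to be compensated by at least 2n+2 further pairs.
--
-- Upper bound.  By Farkas' lemma a game that is not roughly weighted has a relation
-- d·1 + Σ cₖvₖ = 0 with integers d > 0, cₖ ≥ 0, where each vₖ is a unit vector or the difference of a
-- winning and a losing coalition.  By Carathéodory the vₖ may be taken linearly independent; then
-- Cramer's rule replaces the coefficients by minors, which Hadamard's inequality bounds by n^(n/2).
-- The minors are coordinates of wedge products, and Hadamard's inequality is a consequence of
-- |u ∧ f|² + |u ⌟ f|² = |u|²|f|².  The unit vectors are absorbed by enlarging winning coalitions.

open import Defs
open import Axiom.UniquenessOfIdentityProofs.WithK using (uip)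
open import Data.Bool using (Bool; true; false; if_then_else_; _∨_; T)
import Data.Bool as Bool
import Data.Bool.Properties as Bool
open import Data.Empty using (⊥-elim)
open import Data.Fin using (Fin; zero; suc; punchIn)
open import Data.Fin.Patterns using (0F; 1F; 2F; 3F; 4F)
open import Data.Fin.Subset using (Subset; ⊤; ⊥; _⊆_; ⁅_⁆; ∣_∣)
open import Data.Fin.Subset.Properties using (anySubset?; ∣p∣≤n; ⊆-max; ⊆-min)
import Data.Integer as ℤ
import Data.Integer.Properties as ℤ
import Data.Integer.Tactic.RingSolver as ℤ
open import Data.List as List using (List; []; _∷_; _++_; length)
open import Data.List.Extrema ℤ.≤-totalOrder using (argmax; f[xs]≤f[argmax])
open import Data.List.Membership.Propositional using (_∈_)
open import Data.List.Membership.Propositional.Properties using (∈-++⁺ˡ; ∈-++⁺ʳ; ∈-map⁺; ∈-allFin; ∈-cartesianProduct⁺)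
import Data.List.Relation.Unary.All as All
open import Data.List.Relation.Unary.Any using (here; there; index)
open import Data.List.Relation.Unary.Any.Properties using (lookup-index)
open import Data.Nat using (ℕ; zero; suc; z≤n; s≤s; s≤s⁻¹)
import Data.Nat as ℕ
import Data.Nat.Coprimality as Coprime
import Data.Nat.Properties as ℕ
import Data.Nat.Tactic.RingSolver as ℕ
open import Data.Product using (Σ; ∃; _×_; _,_; proj₁; proj₂)
open import Data.Rational using (ℚ; mkℚ; 0ℚ; *≤*) renaming (_+_ to _+ℚ_; -_ to -ℚ_; _<_ to _<ℚ_; _≤_ to _≤ℚ_)
import Data.Rational.Properties as ℚ
open import Data.Rational.Solver using (module +-*-Solver)
import Data.Rational.Unnormalised as ℚᵘ
import Data.Rational.Unnormalised.Properties as ℚᵘ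
open import Data.Sum using (_⊎_; inj₁; inj₂)
open import Data.Vec as Vec using ([]; _∷_; lookup)
import Data.Vec.Functional as Vector
import Data.Vec.Properties as Vec
open import Function using (_∘_)
open import Relation.Binary.PropositionalEquality
open import Relation.Nullary using (¬_; yes; no; ¬?)
open import Relation.Nullary.Decidable using (decidable-stable)

-- The coefficient d of the all-ones vector counts the copies of (P, ∅), so its positivity is what
-- makes the certificate potent. Therefore only the vₖ are thinned out to an independent family, and
-- the all-ones vector is kept apart from them throughout. Once the vₖ are independent, the relation
-- is unique up to a factor: Cramer's minors are proportional to the nonnegative coefficients, have
-- a common sign, and their absolute values form a relation again. The factor n + 1 counts the
-- coefficients, at most n of them for the vₖ. The base n is the squared length of a vector with
-- entries -1, 0 and 1. Since n^(n/2) may be irrational, all estimates are made for squares: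
-- (n+1)²nⁿ is the square of the bound in the theorem. Absorbing unit vectors costs no length,
-- because a player can join a winning coalition without spoiling it. In the lower bound, the
-- threshold 8 lets coalitions such as {0,2,3} lose with 7 points while {0,1} and {2,3,4} win with
-- 6. These inversions exclude rough weights, yet they recover only one point per pair.

bit : Bool → ℕ
bit b = if b then 1 else 0

module UpperBound where

  open import Algebra.Properties.Semiring.Sum ℤ.+-*-semiring
  open import Data.Integer using (ℤ; +_; 0ℤ; 1ℤ; -1ℤ; _+_; _*_; -_; _≤_; _<_; +≤+)

  -- Exterior algebra of ℤⁿ: wedge product, contraction, anticommutation.

  V : ℕ → Set
  V n = Fin n → ℤ

  -- The exterior algebra of ℤⁿ: f I is the coefficient of the wedge product of the basis vectors in I.
  Λ : ℕ → Set
  Λ n = Subset n → ℤ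

  dot : ∀ {n} → V n → V n → ℤ
  dot x u = sum (λ i → x i * u i)

  basis : ∀ {n} → Fin n → V n
  basis zero    zero    = 1ℤ
  basis zero    (suc j) = 0ℤ
  basis (suc i) zero    = 0ℤ
  basis (suc i) (suc j) = basis i j

  sum-zero : ∀ {m} {f : Fin m → ℤ} → (∀ k → f k ≡ 0ℤ) → sum f ≡ 0ℤ
  sum-zero {m} f≡0 = trans (sum-cong-≗ f≡0) (sum-replicate-zero m)

  dot-basis : ∀ {n} (i : Fin n) (u : V n) → dot (basis i) u ≡ u i
  dot-basis zero    u = trans (cong₂ _+_ (ℤ.*-identityˡ (u zero)) (sum-zero (λ k → ℤ.*-zeroˡ (u (suc k))))) (ℤ.+-identityʳ _)
  dot-basis (suc i) u = trans (cong₂ _+_ (ℤ.*-zeroˡ (u zero)) (dot-basis i (u ∘ suc))) (ℤ.+-identityˡ _)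

  infixr 8 _∧_
  infixr 8 _⌟_

  -- Split off the first basis vector e₀ by writing f = f₀ + e₀ ∧ f₁ and u = u₀e₀ + u′. Then u ∧ f =
  -- u′ ∧ f₀ + e₀ ∧ (u₀f₀ - u′ ∧ f₁); the sign comes from moving u′ past e₀.
  _∧_ : ∀ {n} → V n → Λ n → Λ n
  (u ∧ f) []          = 0ℤ
  (u ∧ f) (false ∷ I) = ((u ∘ suc) ∧ (f ∘ (false ∷_))) I
  (u ∧ f) (true  ∷ I) = u zero * f (false ∷ I) + -1ℤ * ((u ∘ suc) ∧ (f ∘ (true ∷_))) I

  -- Contraction by x
  _⌟_ : ∀ {n} → V n → Λ n → Λ n
  (x ⌟ f) []          = 0ℤ
  (x ⌟ f) (false ∷ I) = 1ℤ * ((x ∘ suc) ⌟ (f ∘ (false ∷_))) I + x zero * f (true ∷ I)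
  (x ⌟ f) (true  ∷ I) = -1ℤ * ((x ∘ suc) ⌟ (f ∘ (true ∷_))) I

  ∧-cong : ∀ {n} (u : V n) {f g : Λ n} → (∀ I → f I ≡ g I) → ∀ I → (u ∧ f) I ≡ (u ∧ g) I
  ∧-cong u f≡g []          = refl
  ∧-cong u f≡g (false ∷ I) = ∧-cong (u ∘ suc) (f≡g ∘ (false ∷_)) I
  ∧-cong u f≡g (true  ∷ I) = cong₂ (λ a b → u zero * a + -1ℤ * b) (f≡g (false ∷ I)) (∧-cong (u ∘ suc) (f≡g ∘ (true ∷_)) I)

  -- Both coefficients are explicit so that the clauses of `_∧_` and `_⌟_`, written with factors
  -- `1ℤ` and `-1ℤ`, are literally of the form `c * f J + d * g J`.
  ∧-linear : ∀ {n} (u : V n) c d (f g : Λ n) I →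
    (u ∧ (λ J → c * f J + d * g J)) I ≡ c * (u ∧ f) I + d * (u ∧ g) I
  ∧-linear u c d f g [] = lemma c d
    where lemma : ∀ c d → 0ℤ ≡ c * 0ℤ + d * 0ℤ
          lemma = ℤ.solve-∀
  ∧-linear u c d f g (false ∷ I) = ∧-linear (u ∘ suc) c d _ _ I
  ∧-linear u c d f g (true ∷ I) =
    trans (cong (λ z → u zero * (c * f (false ∷ I) + d * g (false ∷ I)) + -1ℤ * z) (∧-linear (u ∘ suc) c d _ _ I))
          (lemma c d (u zero) (f (false ∷ I)) (g (false ∷ I)) (((u ∘ suc) ∧ (f ∘ (true ∷_))) I) (((u ∘ suc) ∧ (g ∘ (true ∷_))) I))
    where lemma : ∀ c d t a b x y → t * (c * a + d * b) + -1ℤ * (c * x + d * y) ≡ c * (t * a + -1ℤ * x) + d * (t * b + -1ℤ * y)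
          lemma = ℤ.solve-∀

  ⌟-linear : ∀ {n} (u : V n) c d (f g : Λ n) I →
    (u ⌟ (λ J → c * f J + d * g J)) I ≡ c * (u ⌟ f) I + d * (u ⌟ g) I
  ⌟-linear u c d f g [] = lemma c d
    where lemma : ∀ c d → 0ℤ ≡ c * 0ℤ + d * 0ℤ
          lemma = ℤ.solve-∀
  ⌟-linear u c d f g (false ∷ I) =
    trans (cong (λ z → 1ℤ * z + u zero * (c * f (true ∷ I) + d * g (true ∷ I))) (⌟-linear (u ∘ suc) c d _ _ I))
          (lemma c d (u zero) (f (true ∷ I)) (g (true ∷ I)) (((u ∘ suc) ⌟ (f ∘ (false ∷_))) I) (((u ∘ suc) ⌟ (g ∘ (false ∷_))) I))
    where lemma : ∀ c d t a b x y → 1ℤ * (c * x + d * y) + t * (c * a + d * b) ≡ c * (1ℤ * x + t * a) + d * (1ℤ * y + t * b)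
          lemma = ℤ.solve-∀
  ⌟-linear u c d f g (true ∷ I) =
    trans (cong (-1ℤ *_) (⌟-linear (u ∘ suc) c d _ _ I))
          (lemma c d (((u ∘ suc) ⌟ (f ∘ (true ∷_))) I) (((u ∘ suc) ⌟ (g ∘ (true ∷_))) I))
    where lemma : ∀ c d x y → -1ℤ * (c * x + d * y) ≡ c * (-1ℤ * x) + d * (-1ℤ * y)
          lemma = ℤ.solve-∀

  ∧-scale : ∀ {n} (u : V n) c (f : Λ n) I → (u ∧ (λ J → c * f J)) I ≡ c * (u ∧ f) I
  ∧-scale u c f I = begin
    (u ∧ (λ J → c * f J)) I             ≡⟨ ∧-cong u (λ J → lemma c (f J)) I ⟩
    (u ∧ (λ J → c * f J + 0ℤ * f J)) I  ≡⟨ ∧-linear u c 0ℤ f f I ⟩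
    c * (u ∧ f) I + 0ℤ * (u ∧ f) I      ≡⟨ lemma c ((u ∧ f) I) ⟨
    c * (u ∧ f) I                       ∎
    where open ≡-Reasoning
          lemma : ∀ c x → c * x ≡ c * x + 0ℤ * x
          lemma = ℤ.solve-∀

  ∧-zero : ∀ {n} (u : V n) {f : Λ n} → (∀ I → f I ≡ 0ℤ) → ∀ I → (u ∧ f) I ≡ 0ℤ
  ∧-zero u {f} f≡0 I = trans (∧-cong u (λ J → trans (f≡0 J) (sym (ℤ.*-zeroˡ (f J)))) I)
                       (trans (∧-scale u 0ℤ f I) (ℤ.*-zeroˡ ((u ∧ f) I)))

  ∧-sum : ∀ {n m} (u : V n) (c : Fin m → ℤ) (f : Fin m → Λ n) I →
    (u ∧ (λ J → sum (λ k → c k * f k J))) I ≡ sum (λ k → c k * (u ∧ f k) I)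
  ∧-sum {m = zero} u c f I = ∧-zero u (λ _ → refl) I
  ∧-sum {m = suc m} u c f I = begin
    (u ∧ (λ J → c zero * f zero J + sum (λ k → c (suc k) * f (suc k) J))) I
      ≡⟨ ∧-cong u (λ J → cong (λ z → c zero * f zero J + z) (sym (ℤ.*-identityˡ _))) I ⟩
    (u ∧ (λ J → c zero * f zero J + 1ℤ * sum (λ k → c (suc k) * f (suc k) J))) I
      ≡⟨ ∧-linear u (c zero) 1ℤ (f zero) _ I ⟩
    c zero * (u ∧ f zero) I + 1ℤ * (u ∧ (λ J → sum (λ k → c (suc k) * f (suc k) J))) I
      ≡⟨ cong (λ z → c zero * (u ∧ f zero) I + z) (trans (ℤ.*-identityˡ _) (∧-sum u (c ∘ suc) (f ∘ suc) I)) ⟩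
    c zero * (u ∧ f zero) I + sum (λ k → c (suc k) * (u ∧ f (suc k)) I) ∎
    where open ≡-Reasoning

  -- Canonical anticommutation relation
  ⌟-∧ : ∀ {n} (x u : V n) (f : Λ n) I → (x ⌟ u ∧ f) I + (u ∧ x ⌟ f) I ≡ dot x u * f I
  ⌟-∧ x u f [] = sym (ℤ.*-zeroˡ (f []))
  ⌟-∧ x u f (false ∷ I) = begin
    1ℤ * A + x₀ * (u₀ * f₀ I + -1ℤ * B) + (u′ ∧ (λ J → 1ℤ * (x′ ⌟ f₀) J + x₀ * f₁ J)) I
      ≡⟨ cong (λ z → 1ℤ * A + x₀ * (u₀ * f₀ I + -1ℤ * B) + z) (∧-linear u′ 1ℤ x₀ (x′ ⌟ f₀) f₁ I) ⟩
    1ℤ * A + x₀ * (u₀ * f₀ I + -1ℤ * B) + (1ℤ * C + x₀ * B)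
      ≡⟨ lemma₁ A B C x₀ u₀ (f₀ I) ⟩
    x₀ * u₀ * f₀ I + (A + C)
      ≡⟨ cong (λ z → x₀ * u₀ * f₀ I + z) (⌟-∧ x′ u′ f₀ I) ⟩
    x₀ * u₀ * f₀ I + dot x′ u′ * f₀ I
      ≡⟨ ℤ.*-distribʳ-+ (f₀ I) (x₀ * u₀) (dot x′ u′) ⟨
    dot x u * f₀ I ∎
    where
    open ≡-Reasoning
    x₀ = x zero
    u₀ = u zero
    x′ = x ∘ suc
    u′ = u ∘ suc
    f₀ = f ∘ (false ∷_)
    f₁ = f ∘ (true ∷_)
    A = (x′ ⌟ u′ ∧ f₀) I
    B = (u′ ∧ f₁) I
    C = (u′ ∧ x′ ⌟ f₀) I
    lemma₁ : ∀ A B C x₀ u₀ f → 1ℤ * A + x₀ * (u₀ * f + -1ℤ * B) + (1ℤ * C + x₀ * B) ≡ x₀ * u₀ * f + (A + C)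
    lemma₁ = ℤ.solve-∀
  ⌟-∧ x u f (true ∷ I) = begin
    -1ℤ * (x′ ⌟ (λ J → u₀ * f₀ J + -1ℤ * (u′ ∧ f₁) J)) I + (u₀ * (1ℤ * B + x₀ * f₁ I) + -1ℤ * (u′ ∧ (λ J → -1ℤ * (x′ ⌟ f₁) J)) I)
      ≡⟨ cong₂ (λ s t → -1ℤ * s + (u₀ * (1ℤ * B + x₀ * f₁ I) + -1ℤ * t)) (⌟-linear x′ u₀ -1ℤ f₀ (u′ ∧ f₁) I) (∧-scale u′ -1ℤ (x′ ⌟ f₁) I) ⟩
    -1ℤ * (u₀ * B + -1ℤ * A) + (u₀ * (1ℤ * B + x₀ * f₁ I) + -1ℤ * (-1ℤ * C))
      ≡⟨ lemma₁ A B C x₀ u₀ (f₁ I) ⟩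
    x₀ * u₀ * f₁ I + (A + C)
      ≡⟨ cong (λ z → x₀ * u₀ * f₁ I + z) (⌟-∧ x′ u′ f₁ I) ⟩
    x₀ * u₀ * f₁ I + dot x′ u′ * f₁ I
      ≡⟨ ℤ.*-distribʳ-+ (f₁ I) (x₀ * u₀) (dot x′ u′) ⟨
    dot x u * f₁ I ∎
    where
    open ≡-Reasoning
    x₀ = x zero
    u₀ = u zero
    x′ = x ∘ suc
    u′ = u ∘ suc
    f₀ = f ∘ (false ∷_)
    f₁ = f ∘ (true ∷_)
    A = (x′ ⌟ u′ ∧ f₁) I
    B = (x′ ⌟ f₀) I
    C = (u′ ∧ x′ ⌟ f₁) I
    lemma₁ : ∀ A B C x₀ u₀ f → -1ℤ * (u₀ * B + -1ℤ * A) + (u₀ * (1ℤ * B + x₀ * f) + -1ℤ * (-1ℤ * C)) ≡ x₀ * u₀ * f + (A + C)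
    lemma₁ = ℤ.solve-∀

  ∧-anticomm : ∀ {n} (u v : V n) (f : Λ n) I → (u ∧ v ∧ f) I + (v ∧ u ∧ f) I ≡ 0ℤ
  ∧-anticomm u v f [] = refl
  ∧-anticomm u v f (false ∷ I) = ∧-anticomm (u ∘ suc) (v ∘ suc) _ I
  ∧-anticomm u v f (true ∷ I) = begin
    u₀ * A + -1ℤ * (u′ ∧ (λ J → v₀ * f₀ J + -1ℤ * (v′ ∧ f₁) J)) I + (v₀ * B + -1ℤ * (v′ ∧ (λ J → u₀ * f₀ J + -1ℤ * (u′ ∧ f₁) J)) I)
      ≡⟨ cong₂ (λ s t → u₀ * A + -1ℤ * s + (v₀ * B + -1ℤ * t)) (∧-linear u′ v₀ -1ℤ f₀ (v′ ∧ f₁) I) (∧-linear v′ u₀ -1ℤ f₀ (u′ ∧ f₁) I) ⟩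
    u₀ * A + -1ℤ * (v₀ * B + -1ℤ * C) + (v₀ * B + -1ℤ * (u₀ * A + -1ℤ * D))
      ≡⟨ lemma A B C D u₀ v₀ ⟩
    C + D
      ≡⟨ ∧-anticomm u′ v′ f₁ I ⟩
    0ℤ ∎
    where
    open ≡-Reasoning
    u₀ = u zero
    v₀ = v zero
    u′ = u ∘ suc
    v′ = v ∘ suc
    f₀ = f ∘ (false ∷_)
    f₁ = f ∘ (true ∷_)
    A = (v′ ∧ f₀) I
    B = (u′ ∧ f₀) I
    C = (u′ ∧ v′ ∧ f₁) I
    D = (v′ ∧ u′ ∧ f₁) I
    lemma : ∀ A B C D u₀ v₀ → u₀ * A + -1ℤ * (v₀ * B + -1ℤ * C) + (v₀ * B + -1ℤ * (u₀ * A + -1ℤ * D)) ≡ C + D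
    lemma = ℤ.solve-∀

  ∧-nilpotent : ∀ {n} (u : V n) (f : Λ n) I → (u ∧ u ∧ f) I ≡ 0ℤ
  ∧-nilpotent u f I = ℤ.*-cancelˡ-≡ (+ 2) _ 0ℤ (trans (lemma ((u ∧ u ∧ f) I)) (∧-anticomm u u f I))
    where lemma : ∀ x → + 2 * x ≡ x + x
          lemma = ℤ.solve-∀

  -- This is linearity of `_∧_` in the vector, applied to a combination that vanishes.
  ∧-dependent : ∀ {n m} (c : Fin m → ℤ) (us : Fin m → V n) → (∀ i → sum (λ k → c k * us k i) ≡ 0ℤ) →
    ∀ f I → sum (λ k → c k * (us k ∧ f) I) ≡ 0ℤ
  ∧-dependent c us dep f [] = sum-zero (λ k → ℤ.*-zeroʳ (c k))
  ∧-dependent c us dep f (false ∷ I) = ∧-dependent c (λ k → us k ∘ suc) (dep ∘ suc) _ I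
  ∧-dependent c us dep f (true ∷ I) = begin
    sum (λ k → c k * (us k zero * a + -1ℤ * b k))
      ≡⟨ sum-cong-≗ (λ k → lemma (c k) (us k zero) a (b k)) ⟩
    sum (λ k → c k * us k zero * a + -1ℤ * (c k * b k))
      ≡⟨ ∑-distrib-+ (λ k → c k * us k zero * a) (λ k → -1ℤ * (c k * b k)) ⟩
    sum (λ k → c k * us k zero * a) + sum (λ k → -1ℤ * (c k * b k))
      ≡⟨ cong₂ _+_ (*-distribʳ-sum a (λ k → c k * us k zero)) (*-distribˡ-sum -1ℤ (λ k → c k * b k)) ⟨
    sum (λ k → c k * us k zero) * a + -1ℤ * sum (λ k → c k * b k)
      ≡⟨ cong₂ (λ s t → s * a + -1ℤ * t) (dep zero) (∧-dependent c (λ k → us k ∘ suc) (dep ∘ suc) _ I) ⟩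
    0ℤ * a + -1ℤ * 0ℤ
      ≡⟨ cong (_+ 0ℤ) (ℤ.*-zeroˡ a) ⟩
    0ℤ ∎
    where
    open ≡-Reasoning
    a = f (false ∷ I)
    b = λ k → ((us k ∘ suc) ∧ (f ∘ (true ∷_))) I
    lemma : ∀ c u a b → c * (u * a + -1ℤ * b) ≡ c * u * a + -1ℤ * (c * b)
    lemma = ℤ.solve-∀

  -- The inner product for which the basis wedges are orthonormal.

  inner : ∀ {n} → Λ n → Λ n → ℤ
  inner {zero}  f g = f [] * g []
  inner {suc n} f g = inner (f ∘ (false ∷_)) (g ∘ (false ∷_)) + inner (f ∘ (true ∷_)) (g ∘ (true ∷_))

  inner-cong : ∀ {n} {f f′ g g′ : Λ n} → (∀ I → f I ≡ f′ I) → (∀ I → g I ≡ g′ I) → inner f g ≡ inner f′ g′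
  inner-cong {zero}  p q = cong₂ _*_ (p []) (q [])
  inner-cong {suc n} p q = cong₂ _+_ (inner-cong (p ∘ (false ∷_)) (q ∘ (false ∷_))) (inner-cong (p ∘ (true ∷_)) (q ∘ (true ∷_)))

  inner-linearʳ : ∀ {n} c d (h f g : Λ n) → inner h (λ J → c * f J + d * g J) ≡ c * inner h f + d * inner h g
  inner-linearʳ {zero} c d h f g = lemma c d (h []) (f []) (g [])
    where lemma : ∀ c d h f g → h * (c * f + d * g) ≡ c * (h * f) + d * (h * g)
          lemma = ℤ.solve-∀
  inner-linearʳ {suc n} c d h f g =
    trans (cong₂ _+_ (inner-linearʳ c d (h ∘ (false ∷_)) _ _) (inner-linearʳ c d (h ∘ (true ∷_)) _ _))
          (lemma c d (inner (h ∘ (false ∷_)) (f ∘ (false ∷_))) _ _ _)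
    where lemma : ∀ c d x y z w → (c * x + d * y) + (c * z + d * w) ≡ c * (x + z) + d * (y + w)
          lemma = ℤ.solve-∀

  inner-comm : ∀ {n} (f g : Λ n) → inner f g ≡ inner g f
  inner-comm {zero}  f g = ℤ.*-comm (f []) (g [])
  inner-comm {suc n} f g = cong₂ _+_ (inner-comm {n} _ _) (inner-comm {n} _ _)

  inner-scaleʳ : ∀ {n} c (h f : Λ n) → inner h (λ J → c * f J) ≡ c * inner h f
  inner-scaleʳ c h f = begin
    inner h (λ J → c * f J)             ≡⟨ inner-cong {f = h} (λ _ → refl) (λ J → lemma c (f J)) ⟩
    inner h (λ J → c * f J + 0ℤ * f J)  ≡⟨ inner-linearʳ c 0ℤ h f f ⟩
    c * inner h f + 0ℤ * inner h f      ≡⟨ lemma c (inner h f) ⟨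
    c * inner h f                       ∎
    where open ≡-Reasoning
          lemma : ∀ c x → c * x ≡ c * x + 0ℤ * x
          lemma = ℤ.solve-∀

  -- The wedge puts `u₀ f₀` into the `true` half, where it meets `g₁`; the contraction puts `u₀ g₁`
  -- into the `false` half, where it meets `f₀`. These cross terms agree, and the others agree by
  -- induction.
  ∧-⌟-adjoint : ∀ {n} (u : V n) (f g : Λ n) → inner (u ∧ f) g ≡ inner f (u ⌟ g)
  ∧-⌟-adjoint {zero} u f g = sym (ℤ.*-zeroʳ (f []))
  ∧-⌟-adjoint {suc n} u f g = begin
    inner (u′ ∧ f₀) g₀ + inner (λ J → u₀ * f₀ J + -1ℤ * (u′ ∧ f₁) J) g₁
      ≡⟨ cong₂ _+_ (∧-⌟-adjoint u′ f₀ g₀) (trans (inner-comm _ g₁) (inner-linearʳ u₀ -1ℤ g₁ f₀ (u′ ∧ f₁))) ⟩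
    A + (u₀ * inner g₁ f₀ + -1ℤ * inner g₁ (u′ ∧ f₁))
      ≡⟨ cong₂ (λ s t → A + (u₀ * s + -1ℤ * t)) (inner-comm g₁ f₀) (trans (inner-comm g₁ (u′ ∧ f₁)) (∧-⌟-adjoint u′ f₁ g₁)) ⟩
    A + (u₀ * B + -1ℤ * C)
      ≡⟨ lemma A B C u₀ ⟩
    (1ℤ * A + u₀ * B) + -1ℤ * C
      ≡⟨ cong₂ _+_ (inner-linearʳ 1ℤ u₀ f₀ (u′ ⌟ g₀) g₁) (inner-scaleʳ -1ℤ f₁ (u′ ⌟ g₁)) ⟨
    inner f₀ (λ J → 1ℤ * (u′ ⌟ g₀) J + u₀ * g₁ J) + inner f₁ (λ J → -1ℤ * (u′ ⌟ g₁) J) ∎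
    where
    open ≡-Reasoning
    u₀ = u zero
    u′ = u ∘ suc
    f₀ = f ∘ (false ∷_)
    f₁ = f ∘ (true ∷_)
    g₀ = g ∘ (false ∷_)
    g₁ = g ∘ (true ∷_)
    A = inner f₀ (u′ ⌟ g₀)
    B = inner f₀ g₁
    C = inner f₁ (u′ ⌟ g₁)
    lemma : ∀ A B C u → A + (u * B + -1ℤ * C) ≡ (1ℤ * A + u * B) + -1ℤ * C
    lemma = ℤ.solve-∀

  -- Adjointness moves one factor across in each summand and leaves the product of `f` with
  -- `u ⌟ u ∧ f` plus `u ∧ u ⌟ f`, which the anticommutation relation turns into a multiple of `f`.
  ∧-⌟-norm : ∀ {n} (u : V n) (f : Λ n) →
    inner (u ∧ f) (u ∧ f) + inner (u ⌟ f) (u ⌟ f) ≡ dot u u * inner f f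
  ∧-⌟-norm u f = begin
    inner (u ∧ f) (u ∧ f) + inner (u ⌟ f) (u ⌟ f)
      ≡⟨ cong₂ _+_ (∧-⌟-adjoint u f (u ∧ f)) (trans (sym (∧-⌟-adjoint u (u ⌟ f) f)) (inner-comm _ f)) ⟩
    inner f (u ⌟ u ∧ f) + inner f (u ∧ u ⌟ f)
      ≡⟨ cong₂ _+_ (ℤ.*-identityˡ (inner f (u ⌟ u ∧ f))) (ℤ.*-identityˡ (inner f (u ∧ u ⌟ f))) ⟨
    1ℤ * inner f (u ⌟ u ∧ f) + 1ℤ * inner f (u ∧ u ⌟ f)
      ≡⟨ inner-linearʳ 1ℤ 1ℤ f (u ⌟ u ∧ f) (u ∧ u ⌟ f) ⟨
    inner f (λ J → 1ℤ * (u ⌟ u ∧ f) J + 1ℤ * (u ∧ u ⌟ f) J)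
      ≡⟨ inner-cong {f = f} (λ _ → refl) (λ J → trans (cong₂ _+_ (ℤ.*-identityˡ ((u ⌟ u ∧ f) J)) (ℤ.*-identityˡ ((u ∧ u ⌟ f) J))) (⌟-∧ u u f J)) ⟩
    inner f (λ J → dot u u * f J)
      ≡⟨ inner-scaleʳ (dot u u) f f ⟩
    dot u u * inner f f ∎
    where open ≡-Reasoning

  0≤i*i : ∀ i → 0ℤ ≤ i * i
  0≤i*i (+ n)        = subst (0ℤ ≤_) (ℤ.pos-* n n) (+≤+ z≤n)
  0≤i*i (ℤ.-[1+ n ]) = +≤+ z≤n

  0≤inner : ∀ {n} (f : Λ n) → 0ℤ ≤ inner f f
  0≤inner {zero}  f = 0≤i*i (f [])
  0≤inner {suc n} f = ℤ.+-mono-≤ (0≤inner (f ∘ (false ∷_))) (0≤inner (f ∘ (true ∷_)))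

  coordinate²≤inner : ∀ {n} (f : Λ n) I → f I * f I ≤ inner f f
  coordinate²≤inner f [] = ℤ.≤-refl
  coordinate²≤inner f (false ∷ I) = subst (_≤ inner f f) (ℤ.+-identityʳ _)
    (ℤ.+-mono-≤ (coordinate²≤inner (f ∘ (false ∷_)) I) (0≤inner (f ∘ (true ∷_))))
  coordinate²≤inner f (true ∷ I) = subst (_≤ inner f f) (ℤ.+-identityˡ _)
    (ℤ.+-mono-≤ (0≤inner (f ∘ (false ∷_))) (coordinate²≤inner (f ∘ (true ∷_)) I))

  ∧-norm : ∀ {n} (u : V n) (f : Λ n) a b → dot u u ≤ + a → inner f f ≤ + b → inner (u ∧ f) (u ∧ f) ≤ + (a ℕ.* b)
  ∧-norm u f a b u≤a f≤b = begin
    inner (u ∧ f) (u ∧ f)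
      ≡⟨ ℤ.+-identityʳ _ ⟨
    inner (u ∧ f) (u ∧ f) + 0ℤ
      ≤⟨ ℤ.+-monoʳ-≤ (inner (u ∧ f) (u ∧ f)) (0≤inner (u ⌟ f)) ⟩
    inner (u ∧ f) (u ∧ f) + inner (u ⌟ f) (u ⌟ f)
      ≡⟨ ∧-⌟-norm u f ⟩
    dot u u * inner f f
      ≤⟨ ℤ.*-monoʳ-≤-nonNeg (inner f f) {{ℤ.nonNegative (0≤inner f)}} u≤a ⟩
    + a * inner f f
      ≤⟨ ℤ.*-monoˡ-≤-nonNeg (+ a) f≤b ⟩
    + a * + b
      ≡⟨ ℤ.pos-* a b ⟨
    + (a ℕ.* b) ∎
    where open ℤ.≤-Reasoning

  -- Wedge products of families, Cramer's rule and independence.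

  unit : ∀ {n} → Λ n
  unit []          = 1ℤ
  unit (false ∷ I) = unit I
  unit (true  ∷ I) = 0ℤ

  ⋀ : ∀ {n m} → (Fin m → V n) → Λ n
  ⋀ {m = zero}  us = unit
  ⋀ {m = suc m} us = us zero ∧ ⋀ (us ∘ suc)

  -- (-1)^k times the wedge product of all vectors except the k-th
  omit : ∀ {n m} → (Fin m → V n) → Fin m → Λ n
  omit us zero    I = ⋀ (us ∘ suc) I
  omit us (suc k) I = -1ℤ * (us zero ∧ omit (us ∘ suc) k) I

  ⌟-zero : ∀ {n} (x : V n) {f : Λ n} → (∀ I → f I ≡ 0ℤ) → ∀ I → (x ⌟ f) I ≡ 0ℤ
  ⌟-zero x f≡0 []          = refl
  ⌟-zero x f≡0 (false ∷ I) = cong₂ (λ a b → 1ℤ * a + b) (⌟-zero (x ∘ suc) (f≡0 ∘ (false ∷_)) I)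
    (trans (cong (x zero *_) (f≡0 (true ∷ I))) (ℤ.*-zeroʳ (x zero)))
  ⌟-zero x f≡0 (true  ∷ I) = cong (-1ℤ *_) (⌟-zero (x ∘ suc) (f≡0 ∘ (true ∷_)) I)

  ⌟-unit : ∀ {n} (x : V n) I → (x ⌟ unit) I ≡ 0ℤ
  ⌟-unit x []          = refl
  ⌟-unit x (false ∷ I) = cong₂ (λ a b → 1ℤ * a + b) (⌟-unit (x ∘ suc) I) (ℤ.*-zeroʳ (x zero))
  ⌟-unit x (true  ∷ I) = cong (-1ℤ *_) (⌟-zero (x ∘ suc) (λ _ → refl) I)

  -- This is the Laplace expansion: the anticommutation relation carries the contraction past one
  -- vector at a time, and the sign of each passage is stored in `omit`.
  ⌟-⋀ : ∀ {n m} (x : V n) (us : Fin m → V n) I → (x ⌟ ⋀ us) I ≡ sum (λ k → dot x (us k) * omit us k I)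
  ⌟-⋀ {m = zero}  x us I = ⌟-unit x I
  ⌟-⋀ {m = suc m} x us I = begin
    (x ⌟ u ∧ ω) I
      ≡⟨ lemma ((x ⌟ u ∧ ω) I) ((u ∧ x ⌟ ω) I) ⟩
    ((x ⌟ u ∧ ω) I + (u ∧ x ⌟ ω) I) + -1ℤ * (u ∧ x ⌟ ω) I
      ≡⟨ cong₂ (λ s t → s + -1ℤ * t) (⌟-∧ x u ω I) (trans (∧-cong u (⌟-⋀ x (us ∘ suc)) I) (∧-sum u d (omit (us ∘ suc)) I)) ⟩
    dot x u * ω I + -1ℤ * sum (λ k → d k * (u ∧ omit (us ∘ suc) k) I)
      ≡⟨ cong (λ z → dot x u * ω I + z) (*-distribˡ-sum -1ℤ (λ k → d k * (u ∧ omit (us ∘ suc) k) I)) ⟩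
    dot x u * ω I + sum (λ k → -1ℤ * (d k * (u ∧ omit (us ∘ suc) k) I))
      ≡⟨ cong (λ z → dot x u * ω I + z) (sum-cong-≗ (λ k → swap (d k) ((u ∧ omit (us ∘ suc) k) I))) ⟩
    dot x u * ω I + sum (λ k → d k * (-1ℤ * (u ∧ omit (us ∘ suc) k) I)) ∎
    where
    open ≡-Reasoning
    u = us zero
    ω = ⋀ (us ∘ suc)
    d = λ k → dot x (us (suc k))
    lemma : ∀ a b → a ≡ (a + b) + -1ℤ * b
    lemma = ℤ.solve-∀
    swap : ∀ a b → -1ℤ * (a * b) ≡ a * (-1ℤ * b)
    swap = ℤ.solve-∀

  Dependency : ∀ {n m} → (Fin m → ℤ) → (Fin m → V n) → Set
  Dependency c us = ∀ i → sum (λ k → c k * us k i) ≡ 0ℤ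

  -- Cramer's rule
  omit-dependency : ∀ {n m} (us : Fin m → V n) → (∀ I → ⋀ us I ≡ 0ℤ) → ∀ I → Dependency (λ k → omit us k I) us
  omit-dependency us ω≡0 I i = begin
    sum (λ k → omit us k I * us k i)
      ≡⟨ sum-cong-≗ (λ k → trans (ℤ.*-comm (omit us k I) (us k i)) (cong (_* omit us k I) (sym (dot-basis i (us k))))) ⟩
    sum (λ k → dot (basis i) (us k) * omit us k I)
      ≡⟨ ⌟-⋀ (basis i) us I ⟨
    (basis i ⌟ ⋀ us) I
      ≡⟨ ⌟-zero (basis i) ω≡0 I ⟩
    0ℤ ∎
    where open ≡-Reasoning

  member-∧-⋀ : ∀ {n m} (us : Fin m → V n) k I → (us k ∧ ⋀ us) I ≡ 0ℤ
  member-∧-⋀ us zero    I = ∧-nilpotent (us zero) _ I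
  member-∧-⋀ us (suc k) I = begin
    (us (suc k) ∧ us zero ∧ ω) I
      ≡⟨ ℤ.+-identityʳ _ ⟨
    (us (suc k) ∧ us zero ∧ ω) I + 0ℤ
      ≡⟨ cong (λ z → (us (suc k) ∧ us zero ∧ ω) I + z) (∧-zero (us zero) (member-∧-⋀ (us ∘ suc) k) I) ⟨
    (us (suc k) ∧ us zero ∧ ω) I + (us zero ∧ us (suc k) ∧ ω) I
      ≡⟨ ∧-anticomm (us (suc k)) (us zero) ω I ⟩
    0ℤ ∎
    where open ≡-Reasoning
          ω = ⋀ (us ∘ suc)

  -- Wedge the dependency with all vectors but the first: every other term then contains a repeated
  -- vector.
  dependent-head : ∀ {n m} (c : Fin (suc m) → ℤ) (us : Fin (suc m) → V n) → Dependency c us → ∀ I → c zero * ⋀ us I ≡ 0ℤ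
  dependent-head c us dep I = begin
    c zero * ⋀ us I
      ≡⟨ ℤ.+-identityʳ _ ⟨
    c zero * ⋀ us I + 0ℤ
      ≡⟨ cong (λ z → c zero * ⋀ us I + z) (sum-zero (λ k → trans (cong (c (suc k) *_) (member-∧-⋀ (us ∘ suc) k I)) (ℤ.*-zeroʳ (c (suc k))))) ⟨
    sum (λ k → c k * (us k ∧ ⋀ (us ∘ suc)) I)
      ≡⟨ ∧-dependent c us dep (⋀ (us ∘ suc)) I ⟩
    0ℤ ∎
    where open ≡-Reasoning

  *-zero-cancelˡ : ∀ {i j} → i ≢ 0ℤ → i * j ≡ 0ℤ → j ≡ 0ℤ
  *-zero-cancelˡ {i} i≢0 ij≡0 with ℤ.i*j≡0⇒i≡0∨j≡0 i ij≡0
  ... | inj₁ i≡0 = ⊥-elim (i≢0 i≡0)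
  ... | inj₂ j≡0 = j≡0

  -- A single nonzero coordinate of the wedge thus forces all coefficients to vanish. Instead of
  -- permuting the k-th vector to the front, the proof looks at `c zero`: if it is nonzero, the
  -- whole wedge vanishes; if it is zero, the dependency lives on the tail, and the first vector is
  -- wedged on afterwards.
  independent : ∀ {n m} (c : Fin m → ℤ) (us : Fin m → V n) → Dependency c us → ∀ k I → c k * ⋀ us I ≡ 0ℤ
  independent c us dep zero I = dependent-head c us dep I
  independent c us dep (suc k) I with c zero ℤ.≟ 0ℤ
  ... | no c₀≢0 = trans (cong (c (suc k) *_) (*-zero-cancelˡ c₀≢0 (dependent-head c us dep I))) (ℤ.*-zeroʳ (c (suc k)))
  ... | yes c₀≡0 = trans (sym (∧-scale (us zero) (c (suc k)) (⋀ (us ∘ suc)) I))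
                         (∧-zero (us zero) (independent (c ∘ suc) (us ∘ suc) dep′ k) I)
    where
    dep′ : Dependency (c ∘ suc) (us ∘ suc)
    dep′ i = trans (sym (ℤ.+-identityˡ _))
      (trans (cong (λ z → z + sum (λ k → c (suc k) * us (suc k) i)) (sym (trans (cong (_* us zero i) c₀≡0) (ℤ.*-zeroˡ (us zero i)))))
             (dep i))

  -- The offset j makes the statement stable under passing to the components of f.
  ∧-degree : ∀ {n} (u : V n) (f : Λ n) j d → (∀ I → j ℕ.+ ∣ I ∣ ≢ d → f I ≡ 0ℤ) →
    ∀ I → j ℕ.+ ∣ I ∣ ≢ suc d → (u ∧ f) I ≡ 0ℤ
  ∧-degree u f j d f≡0 []          _ = refl
  ∧-degree u f j d f≡0 (false ∷ I) p = ∧-degree (u ∘ suc) _ j d (f≡0 ∘ (false ∷_)) I p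
  ∧-degree u f j d f≡0 (true  ∷ I) p = trans
    (cong₂ (λ a b → u zero * a + -1ℤ * b)
      (f≡0 (false ∷ I) (λ e → p (trans (ℕ.+-suc j ∣ I ∣) (cong suc e))))
      (∧-degree (u ∘ suc) _ (suc j) d
        (λ J q → f≡0 (true ∷ J) (λ e → q (trans (sym (ℕ.+-suc j ∣ J ∣)) e))) I
        (λ e → p (trans (ℕ.+-suc j ∣ I ∣) e))))
    (trans (ℤ.+-identityʳ _) (ℤ.*-zeroʳ (u zero)))

  unit-degree : ∀ {n} (I : Subset n) → ∣ I ∣ ≢ 0 → unit I ≡ 0ℤ
  unit-degree []          p = ⊥-elim (p refl)
  unit-degree (false ∷ I) p = unit-degree I p
  unit-degree (true  ∷ I) p = refl

  ⋀-degree : ∀ {n m} (us : Fin m → V n) I → ∣ I ∣ ≢ m → ⋀ us I ≡ 0ℤ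
  ⋀-degree {m = zero}  us = unit-degree
  ⋀-degree {m = suc m} us = ∧-degree (us zero) _ 0 m (⋀-degree (us ∘ suc))

  -- The grading replaces a rank argument: a nonzero coordinate can only sit at a set of exactly `m`
  -- indices.
  ⋀-nonzero⇒m≤n : ∀ {n m} (us : Fin m → V n) I → ⋀ us I ≢ 0ℤ → m ℕ.≤ n
  ⋀-nonzero⇒m≤n {n} {m} us I ω≢0 with ∣ I ∣ ℕ.≟ m
  ... | yes e = subst (ℕ._≤ n) e (∣p∣≤n I)
  ... | no ne = ⊥-elim (ω≢0 (⋀-degree us I ne))

  -- Bounds for the minors.

  inner-zero : ∀ {n} → inner {n} (λ _ → 0ℤ) (λ _ → 0ℤ) ≡ 0ℤ
  inner-zero {zero}  = refl
  inner-zero {suc n} = cong₂ _+_ (inner-zero {n}) (inner-zero {n})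

  inner-unit : ∀ {n} → inner {n} unit unit ≡ 1ℤ
  inner-unit {zero}  = refl
  inner-unit {suc n} = cong₂ _+_ (inner-unit {n}) (inner-zero {n})

  -- Hadamard's inequality
  ⋀-norm : ∀ {n m} N (us : Fin m → V n) → (∀ k → dot (us k) (us k) ≤ + N) → inner (⋀ us) (⋀ us) ≤ + (N ℕ.^ m)
  ⋀-norm {n} {zero} N us _ = ℤ.≤-reflexive (inner-unit {n})
  ⋀-norm {m = suc m} N us b = ∧-norm (us zero) _ N (N ℕ.^ m) (b zero) (⋀-norm N (us ∘ suc) (b ∘ suc))

  omit-norm : ∀ {n m} N (us : Fin (suc m) → V n) → (∀ k → dot (us k) (us k) ≤ + N) →
    ∀ k → inner (omit us k) (omit us k) ≤ + (N ℕ.^ m)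
  omit-norm N us b zero = ⋀-norm N (us ∘ suc) (b ∘ suc)
  omit-norm {m = suc m} N us b (suc k) = subst (_≤ + (N ℕ.^ suc m)) (sym neg-norm)
    (∧-norm (us zero) _ N (N ℕ.^ m) (b zero) (omit-norm N (us ∘ suc) (b ∘ suc) k))
    where
    g = us zero ∧ omit (us ∘ suc) k
    neg-norm : inner (λ I → -1ℤ * g I) (λ I → -1ℤ * g I) ≡ inner g g
    neg-norm = trans (inner-scaleʳ -1ℤ (λ I → -1ℤ * g I) g)
      (trans (cong (-1ℤ *_) (trans (inner-comm _ g) (inner-scaleʳ -1ℤ g g))) (lemma (inner g g)))
      where lemma : ∀ x → -1ℤ * (-1ℤ * x) ≡ x
            lemma = ℤ.solve-∀

  abs² : ∀ i N → i * i ≤ + N → ℤ.∣ i ∣ ℕ.* ℤ.∣ i ∣ ℕ.≤ N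
  abs² i N i²≤N = ℤ.drop‿+≤+ (subst (_≤ + N) (trans (sym (ℤ.0≤i⇒+∣i∣≡i (0≤i*i i))) (cong +_ (ℤ.abs-* i i))) i²≤N)

  -- Nonnegative relations and their reduction to independent vectors.

  zero⊎nonzero : ∀ {n} (f : Λ n) → (∀ I → f I ≡ 0ℤ) ⊎ (∃ λ I → f I ≢ 0ℤ)
  zero⊎nonzero f with anySubset? (λ I → ¬? (f I ℤ.≟ 0ℤ))
  ... | yes p = inj₂ p
  ... | no ¬p = inj₁ (λ I → decidable-stable (f I ℤ.≟ 0ℤ) (λ q → ¬p (I , q)))

  -- Cramer's coefficients may all be zero, so vectors are removed from the front until the rest has
  -- a nonzero wedge. A coordinate of that wedge is then the leading coefficient. The search ends
  -- because the empty wedge `unit` is nonzero.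
  nontrivial-dependency : ∀ {n m} (us : Fin m → V n) → (∀ I → ⋀ us I ≡ 0ℤ) →
    ∃ λ ν → Dependency ν us × ∃ λ k → ν k ≢ 0ℤ
  nontrivial-dependency {n} {zero} us ω≡0 = ⊥-elim (unit≢0 n ω≡0)
    where
    unit≢0 : ∀ n → ¬ (∀ (I : Subset n) → unit I ≡ 0ℤ)
    unit≢0 zero    p with p []
    ... | ()
    unit≢0 (suc n) p = unit≢0 n (p ∘ (false ∷_))
  nontrivial-dependency {m = suc m} us ω≡0 with zero⊎nonzero (⋀ (us ∘ suc))
  ... | inj₂ (I , ω≢0) = (λ k → omit us k I) , omit-dependency us ω≡0 I , zero , ω≢0
  ... | inj₁ ω′≡0 with nontrivial-dependency (us ∘ suc) ω′≡0
  ... | ν , dep , k , νk≢0 = ν′ , (λ i → cong₂ _+_ (ℤ.*-zeroˡ (us zero i)) (dep i)) , suc k , νk≢0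
    where
    ν′ : Fin (suc m) → ℤ
    ν′ zero    = 0ℤ
    ν′ (suc k) = ν k

  Dependency-scale : ∀ {n m} a (c : Fin m → ℤ) (us : Fin m → V n) → Dependency c us → Dependency (λ k → a * c k) us
  Dependency-scale a c us dep i = begin
    sum (λ k → a * c k * us k i)    ≡⟨ sum-cong-≗ (λ k → ℤ.*-assoc a (c k) (us k i)) ⟩
    sum (λ k → a * (c k * us k i))  ≡⟨ *-distribˡ-sum a (λ k → c k * us k i) ⟨
    a * sum (λ k → c k * us k i)    ≡⟨ cong (a *_) (dep i) ⟩
    a * 0ℤ                          ≡⟨ ℤ.*-zeroʳ a ⟩
    0ℤ                              ∎
    where open ≡-Reasoning

  Dependency-+ : ∀ {n m} (c d : Fin m → ℤ) (us : Fin m → V n) → Dependency c us → Dependency d us → Dependency (λ k → c k + d k) us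
  Dependency-+ c d us p q i = begin
    sum (λ k → (c k + d k) * us k i)                        ≡⟨ sum-cong-≗ (λ k → ℤ.*-distribʳ-+ (us k i) (c k) (d k)) ⟩
    sum (λ k → c k * us k i + d k * us k i)                 ≡⟨ ∑-distrib-+ (λ k → c k * us k i) (λ k → d k * us k i) ⟩
    sum (λ k → c k * us k i) + sum (λ k → d k * us k i)     ≡⟨ cong₂ _+_ (p i) (q i) ⟩
    0ℤ                                                      ∎
    where open ≡-Reasoning

  Dependency-cancel : ∀ {n m} a (c : Fin m → ℤ) (us : Fin m → V n) → a ≢ 0ℤ → Dependency (λ k → a * c k) us → Dependency c us
  Dependency-cancel a c us a≢0 dep i = *-zero-cancelˡ a≢0 (begin
    a * sum (λ k → c k * us k i)    ≡⟨ *-distribˡ-sum a (λ k → c k * us k i) ⟩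
    sum (λ k → a * (c k * us k i))  ≡⟨ sum-cong-≗ (λ k → ℤ.*-assoc a (c k) (us k i)) ⟨
    sum (λ k → a * c k * us k i)    ≡⟨ dep i ⟩
    0ℤ ∎)
    where open ≡-Reasoning

  Dependency-cong : ∀ {n m} {c d : Fin m → ℤ} (us : Fin m → V n) → (∀ k → c k ≡ d k) → Dependency c us → Dependency d us
  Dependency-cong us c≡d dep i = trans (sum-cong-≗ (λ k → cong (_* us k i) (sym (c≡d k)))) (dep i)

  0≤* : ∀ {i j} → 0ℤ ≤ i → 0ℤ ≤ j → 0ℤ ≤ i * j
  0≤* {i} {j} 0≤i 0≤j = ℤ.*-monoʳ-≤-nonNeg j {{ℤ.nonNegative 0≤j}} 0≤i

  0<* : ∀ {i j} → 0ℤ < i → 0ℤ < j → 0ℤ < i * j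
  0<* {i} {j} 0<i 0<j = ℤ.*-monoʳ-<-pos j {{ℤ.positive 0<j}} 0<i

  -- Transitivity of a/b ≤ c/d ≤ e/f, cross-multiplied in order to stay within ℤ.
  cross-trans : ∀ {a b c d e f} → 0ℤ < b → 0ℤ < d → 0ℤ < f → a * d ≤ c * b → c * f ≤ e * d → a * f ≤ e * b
  cross-trans {a} {b} {c} {d} {e} {f} 0<b 0<d 0<f ad≤cb cf≤ed =
    ℤ.*-cancelʳ-≤-pos (a * f) (e * b) d {{ℤ.positive 0<d}} (begin
      a * f * d  ≡⟨ swap a f d ⟩
      a * d * f  ≤⟨ ℤ.*-monoʳ-≤-nonNeg f {{ℤ.nonNegative (ℤ.<⇒≤ 0<f)}} ad≤cb ⟩
      c * b * f  ≡⟨ swap c b f ⟩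
      c * f * b  ≤⟨ ℤ.*-monoʳ-≤-nonNeg b {{ℤ.nonNegative (ℤ.<⇒≤ 0<b)}} cf≤ed ⟩
      e * d * b  ≡⟨ swap e d b ⟩
      e * b * d  ∎)
    where
    open ℤ.≤-Reasoning
    swap : ∀ x y z → x * y * z ≡ x * z * y
    swap = ℤ.solve-∀

  -- The ratio test of the simplex method: `j` minimises c/ν where ν is positive, so subtracting
  -- that multiple of ν from a nonnegative c annihilates entry `j` and makes no entry negative.
  min-ratio : ∀ {m} (c ν : Fin m → ℤ) →
    (∀ k → ν k ≤ 0ℤ) ⊎ (∃ λ j → 0ℤ < ν j × ∀ k → 0ℤ < ν k → c j * ν k ≤ c k * ν j)
  min-ratio {zero}  c ν = inj₁ λ ()
  min-ratio {suc m} c ν with min-ratio (c ∘ suc) (ν ∘ suc) | 0ℤ ℤ.<? ν zero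
  ... | inj₁ ν≤0 | no ¬0<ν₀ = inj₁ λ where
    zero    → ℤ.≮⇒≥ ¬0<ν₀
    (suc k) → ν≤0 k
  ... | inj₁ ν≤0 | yes 0<ν₀ = inj₂ (zero , 0<ν₀ , λ where
    zero    _    → ℤ.≤-refl
    (suc k) 0<νk → ⊥-elim (ℤ.<⇒≱ 0<νk (ν≤0 k)))
  ... | inj₂ (j , 0<νj , min) | no ¬0<ν₀ = inj₂ (suc j , 0<νj , λ where
    zero    0<ν₀ → ⊥-elim (¬0<ν₀ 0<ν₀)
    (suc k) 0<νk → min k 0<νk)
  ... | inj₂ (j , 0<νj , min) | yes 0<ν₀ with ℤ.≤-total (c zero * ν (suc j)) (c (suc j) * ν zero)
  ... | inj₁ c₀≤ = inj₂ (zero , 0<ν₀ , λ where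
    zero    _    → ℤ.≤-refl
    (suc k) 0<νk → cross-trans {a = c zero} {c = c (suc j)} {e = c (suc k)} 0<ν₀ 0<νj 0<νk c₀≤ (min k 0<νk))
  ... | inj₂ c₀≥ = inj₂ (suc j , 0<νj , λ where
    zero    _    → c₀≥
    (suc k) 0<νk → min k 0<νk)

  positive-dependency : ∀ {n m} (ν : Fin m → ℤ) (us : Fin m → V n) → Dependency ν us → (∃ λ k → ν k ≢ 0ℤ) →
    ∃ λ ν′ → Dependency ν′ us × ∃ λ k → 0ℤ < ν′ k
  positive-dependency ν us dep (k , νk≢0) with 0ℤ ℤ.<? ν k
  ... | yes 0<νk = ν , dep , k , 0<νk
  ... | no ¬0<νk = (λ l → -1ℤ * ν l) , Dependency-scale -1ℤ ν us dep , k ,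
    subst (0ℤ <_) (sym (ℤ.-1*i≡-i (ν k))) (ℤ.neg-mono-< (ℤ.≤∧≢⇒< (ℤ.≮⇒≥ ¬0<νk) νk≢0))

  -- `u₀` is separated from `us` because its coefficient has to stay positive while members of `us`
  -- are discarded.
  Relation : ∀ {n m} → V n → (Fin m → V n) → (Fin (suc m) → ℤ) → Set
  Relation u₀ us c = (∀ k → 0ℤ ≤ c k) × 0ℤ < c zero × Dependency c (u₀ Vector.∷ us)

  -- Carathéodory's reduction step
  drop-vector : ∀ {n m} (u₀ : V n) (us : Fin (suc m) → V n) (ν : Fin (suc m) → ℤ) → Dependency ν us →
    (∃ λ k → ν k ≢ 0ℤ) → ∀ c → Relation u₀ us c → ∃ λ j → ∃ λ d → Relation u₀ (us ∘ punchIn j) d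
  drop-vector u₀ us ν₁ dep₁ nz₁ c (0≤c , 0<c₀ , depc) with positive-dependency ν₁ us dep₁ nz₁
  ... | ν , dep , k₀ , 0<νk₀ with min-ratio (c ∘ suc) ν
  ... | inj₁ ν≤0 = ⊥-elim (ℤ.<⇒≱ 0<νk₀ (ν≤0 k₀))
  ... | inj₂ (j , 0<νj , min) = j , d′ , 0≤d′ , 0<d₀ , depd′
    where
    cj = c (suc j)
    d : Fin _ → ℤ
    -- The step along ν by the minimal ratio, cleared of denominators. The leading 0 ensures that
    -- the coefficient of `u₀` is merely scaled by the positive `ν j`.
    d k = ν j * c k + - cj * (0ℤ Vector.∷ ν) k
    depd : Dependency d (u₀ Vector.∷ us)
    depd = Dependency-+ (λ k → ν j * c k) (λ k → - cj * (0ℤ Vector.∷ ν) k) (u₀ Vector.∷ us) (Dependency-scale (ν j) c (u₀ Vector.∷ us) depc) (Dependency-scale (- cj) (0ℤ Vector.∷ ν) (u₀ Vector.∷ us)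
      (λ i → cong₂ _+_ (ℤ.*-zeroˡ (u₀ i)) (dep i)))
    lemma : ∀ a b c e → a * b + - c * e ≡ b * a + - (c * e)
    lemma = ℤ.solve-∀
    0≤d : ∀ k → 0ℤ ≤ d k
    0≤d zero = subst (0ℤ ≤_) (sym (trans (cong (λ z → ν j * c zero + z) (ℤ.*-zeroʳ (- cj))) (ℤ.+-identityʳ _))) (0≤* (ℤ.<⇒≤ 0<νj) (0≤c zero))
    0≤d (suc k) with 0ℤ ℤ.<? ν k
    ... | yes 0<νk = subst (0ℤ ≤_) (sym (lemma (ν j) (c (suc k)) cj (ν k))) (ℤ.i≤j⇒0≤j-i (min k 0<νk))
    ... | no ¬0<νk = ℤ.+-mono-≤ (0≤* (ℤ.<⇒≤ 0<νj) (0≤c (suc k)))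
      (subst (0ℤ ≤_) (neg-neg cj (ν k)) (0≤* (0≤c (suc j)) (ℤ.neg-mono-≤ (ℤ.≮⇒≥ ¬0<νk))))
      where
      neg-neg : ∀ a b → a * - b ≡ - a * b
      neg-neg = ℤ.solve-∀
    dj≡0 : d (suc j) ≡ 0ℤ
    dj≡0 = cancel (ν j) cj
      where cancel : ∀ a b → a * b + - b * a ≡ 0ℤ
            cancel = ℤ.solve-∀
    d′ : Fin _ → ℤ
    d′ zero    = d zero
    d′ (suc k) = d (suc (punchIn j k))
    0≤d′ : ∀ k → 0ℤ ≤ d′ k
    0≤d′ zero    = 0≤d zero
    0≤d′ (suc k) = 0≤d (suc (punchIn j k))
    0<d₀ : 0ℤ < d zero
    0<d₀ = subst (0ℤ <_) (sym (trans (cong (λ z → ν j * c zero + z) (ℤ.*-zeroʳ (- cj))) (ℤ.+-identityʳ _))) (0<* 0<νj 0<c₀)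
    depd′ : Dependency d′ (u₀ Vector.∷ (us ∘ punchIn j))
    depd′ i = trans (cong (λ z → d zero * u₀ i + z) (sym (begin
      sum (λ k → d (suc k) * us k i)
        ≡⟨ sum-remove {i = j} (λ k → d (suc k) * us k i) ⟩
      d (suc j) * us j i + sum (λ k → d′ (suc k) * us (punchIn j k) i)
        ≡⟨ cong (λ z → z * us j i + sum (λ k → d′ (suc k) * us (punchIn j k) i)) dj≡0 ⟩
      0ℤ * us j i + sum (λ k → d′ (suc k) * us (punchIn j k) i)
        ≡⟨ cong (λ z → z + sum (λ k → d′ (suc k) * us (punchIn j k) i)) (ℤ.*-zeroˡ (us j i)) ⟩
      0ℤ + sum (λ k → d′ (suc k) * us (punchIn j k) i)
        ≡⟨ ℤ.+-identityˡ _ ⟩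
      sum (λ k → d′ (suc k) * us (punchIn j k) i) ∎))) (depd i)
      where open ≡-Reasoning

  record Circuit {n m : ℕ} (N : ℕ) (u₀ : V n) (us : Fin m → V n) : Set where
    field
      m≤n        : m ℕ.≤ n
      coeff      : Fin (suc m) → ℕ
      0<coeff₀   : 0 ℕ.< coeff zero
      coeff²≤    : ∀ k → coeff k ℕ.* coeff k ℕ.≤ N ℕ.^ m
      dependency : Dependency (λ k → + coeff k) (u₀ Vector.∷ us)
  open Circuit

  -- Both `c` and the minors `μ` are dependencies of `v`, and `D` is the leading entry of `μ`. The
  -- combination `e` therefore has leading entry 0, is a dependency of the independent `us`, and
  -- vanishes. So `μ` is proportional to the nonnegative `c`, and passing to absolute values
  -- preserves the dependency.
  cramer : ∀ {n m} N (u₀ : V n) (us : Fin m → V n) → (∀ k → dot ((u₀ Vector.∷ us) k) ((u₀ Vector.∷ us) k) ≤ + N) →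
    ∀ I → ⋀ us I ≢ 0ℤ → ∀ c → Relation u₀ us c → Circuit N u₀ us
  cramer N u₀ us bound I ω≢0 c (0≤c , 0<c₀ , depc) = record
    { m≤n        = ⋀-nonzero⇒m≤n us I ω≢0
    ; coeff      = λ k → ℤ.∣ μ k ∣
    ; 0<coeff₀   = ℕ.n≢0⇒n>0 (λ e → ω≢0 (ℤ.∣i∣≡0⇒i≡0 e))
    ; coeff²≤    = λ k → abs² (μ k) _ (ℤ.≤-trans (coordinate²≤inner (omit v k) I) (omit-norm N v bound k))
    ; dependency = Dependency-cancel (c zero) (λ k → + ℤ.∣ μ k ∣) v c₀≢0 (Dependency-cong {c = λ k → + ℤ.∣ D ∣ * c k} v (λ k → sym (abs-proportional k))
        (Dependency-scale (+ ℤ.∣ D ∣) c v depc))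
    }
    where
    v = u₀ Vector.∷ us
    D = ⋀ us I
    μ = λ k → omit v k I
    c₀≢0 : c zero ≢ 0ℤ
    c₀≢0 e = ℤ.<-irrefl (sym e) 0<c₀
    e : Fin _ → ℤ
    e k = D * c k + - c zero * μ k
    e₀≡0 : e zero ≡ 0ℤ
    e₀≡0 = cancel D (c zero)
      where cancel : ∀ a b → a * b + - b * a ≡ 0ℤ
            cancel = ℤ.solve-∀
    depe : Dependency e v
    depe = Dependency-+ (λ k → D * c k) (λ k → - c zero * μ k) v (Dependency-scale D c v depc) (Dependency-scale (- c zero) μ v
      (omit-dependency v (λ J → *-zero-cancelˡ c₀≢0 (dependent-head c v depc J)) I))
    depe′ : Dependency (e ∘ suc) us
    depe′ i = trans (sym (ℤ.+-identityˡ _)) (trans (cong (λ z → z + sum (λ k → e (suc k) * us k i))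
      (sym (trans (cong (_* u₀ i) e₀≡0) (ℤ.*-zeroˡ (u₀ i))))) (depe i))
    e≡0 : ∀ k → e k ≡ 0ℤ
    e≡0 zero    = e₀≡0
    e≡0 (suc k) = *-zero-cancelˡ ω≢0 (trans (ℤ.*-comm D (e (suc k))) (independent (e ∘ suc) us depe′ k I))
    proportional : ∀ k → D * c k ≡ c zero * μ k
    proportional k = trans (lemma (D * c k) (c zero) (μ k)) (trans (cong (_+ c zero * μ k) (e≡0 k)) (ℤ.+-identityˡ _))
      where lemma : ∀ a b c → a ≡ (a + - b * c) + b * c
            lemma = ℤ.solve-∀
    abs-proportional : ∀ k → c zero * + ℤ.∣ μ k ∣ ≡ + ℤ.∣ D ∣ * c k
    abs-proportional k = begin
      c zero * + ℤ.∣ μ k ∣              ≡⟨ cong (_* + ℤ.∣ μ k ∣) (ℤ.0≤i⇒+∣i∣≡i (0≤c zero)) ⟨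
      + ℤ.∣ c zero ∣ * + ℤ.∣ μ k ∣      ≡⟨ ℤ.pos-* ℤ.∣ c zero ∣ ℤ.∣ μ k ∣ ⟨
      + (ℤ.∣ c zero ∣ ℕ.* ℤ.∣ μ k ∣)    ≡⟨ cong +_ (ℤ.abs-* (c zero) (μ k)) ⟨
      + ℤ.∣ c zero * μ k ∣              ≡⟨ cong (λ z → + ℤ.∣ z ∣) (proportional k) ⟨
      + ℤ.∣ D * c k ∣                   ≡⟨ cong +_ (ℤ.abs-* D (c k)) ⟩
      + (ℤ.∣ D ∣ ℕ.* ℤ.∣ c k ∣)         ≡⟨ ℤ.pos-* ℤ.∣ D ∣ ℤ.∣ c k ∣ ⟩
      + ℤ.∣ D ∣ * + ℤ.∣ c k ∣           ≡⟨ cong (+ ℤ.∣ D ∣ *_) (ℤ.0≤i⇒+∣i∣≡i (0≤c k)) ⟩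
      + ℤ.∣ D ∣ * c k                   ∎
      where open ≡-Reasoning

  -- The family is indexed through labels in `A` so that the surviving vectors still tell which
  -- coalitions or players they came from.
  circuit : ∀ {n} {A : Set} N (u₀ : V n) (vec : A → V n) → dot u₀ u₀ ≤ + N → (∀ a → dot (vec a) (vec a) ≤ + N) →
    ∀ m (g : Fin m → A) c → Relation u₀ (vec ∘ g) c → ∃ λ m′ → Σ (Fin m′ → A) λ g′ → Circuit N u₀ (vec ∘ g′)
  circuit N u₀ vec b₀ b m g c rel with zero⊎nonzero (⋀ (vec ∘ g))
  ... | inj₂ (I , ω≢0) = m , g , cramer N u₀ (vec ∘ g) (λ { zero → b₀ ; (suc k) → b (g k) }) I ω≢0 c rel
  ... | inj₁ ω≡0 with nontrivial-dependency (vec ∘ g) ω≡0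
  circuit N u₀ vec b₀ b zero    g c rel | inj₁ ω≡0 | ν , dep , () , _
  circuit N u₀ vec b₀ b (suc m) g c rel | inj₁ ω≡0 | ν , dep , nz with drop-vector u₀ (vec ∘ g) ν dep nz c rel
  ... | j , d , rel′ = circuit N u₀ vec b₀ b m (g ∘ punchIn j) d rel′

  -- Farkas' lemma over the integers.

  dot-+ˡ : ∀ {n} a b (u v w : V n) → dot (λ i → a * u i + b * v i) w ≡ a * dot u w + b * dot v w
  dot-+ˡ a b u v w = begin
    sum (λ i → (a * u i + b * v i) * w i)                      ≡⟨ sum-cong-≗ (λ i → lemma a b (u i) (v i) (w i)) ⟩
    sum (λ i → a * (u i * w i) + b * (v i * w i))              ≡⟨ ∑-distrib-+ (λ i → a * (u i * w i)) (λ i → b * (v i * w i)) ⟩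
    sum (λ i → a * (u i * w i)) + sum (λ i → b * (v i * w i))  ≡⟨ cong₂ _+_ (*-distribˡ-sum a (λ i → u i * w i)) (*-distribˡ-sum b (λ i → v i * w i)) ⟨
    a * dot u w + b * dot v w                                  ∎
    where
    open ≡-Reasoning
    lemma : ∀ a b u v w → (a * u + b * v) * w ≡ a * (u * w) + b * (v * w)
    lemma = ℤ.solve-∀

  dot-comm : ∀ {n} (u v : V n) → dot u v ≡ dot v u
  dot-comm u v = sum-cong-≗ (λ i → ℤ.*-comm (u i) (v i))

  dot-+ʳ : ∀ {n} a b (u v w : V n) → dot w (λ i → a * u i + b * v i) ≡ a * dot w u + b * dot w v
  dot-+ʳ a b u v w = trans (dot-comm w (λ i → a * u i + b * v i)) (trans (dot-+ˡ a b u v w) (cong₂ (λ s t → a * s + b * t) (dot-comm u w) (dot-comm v w)))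

  -- The base case of `farkas`: the cone without generators is the origin, and a nonzero `b` is
  -- separated from it by -b.
  zero⊎-self-negative : ∀ {n} (b : V n) → (∀ i → b i ≡ 0ℤ) ⊎ dot b (λ i → -1ℤ * b i) < 0ℤ
  zero⊎-self-negative {zero} b = inj₁ λ ()
  zero⊎-self-negative {suc n} b with b zero ℤ.≟ 0ℤ | zero⊎-self-negative (b ∘ suc)
  ... | yes b₀≡0 | inj₁ b≡0 = inj₁ λ { zero → b₀≡0 ; (suc i) → b≡0 i }
  ... | _        | inj₂ neg = inj₂ (ℤ.+-mono-≤-< (nonpos (b zero)) neg)
    where
    nonpos : ∀ i → i * (-1ℤ * i) ≤ 0ℤ
    nonpos i = subst (_≤ 0ℤ) (lemma i) (ℤ.neg-mono-≤ (0≤i*i i))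
      where lemma : ∀ i → - (i * i) ≡ i * (-1ℤ * i)
            lemma = ℤ.solve-∀
  ... | no b₀≢0  | inj₁ b≡0 = inj₂ (ℤ.+-mono-<-≤ (neg (b zero) b₀≢0) (ℤ.≤-reflexive (sum-zero (λ i → trans (cong (_* (-1ℤ * b (suc i))) (b≡0 i)) (ℤ.*-zeroˡ (-1ℤ * b (suc i)))))))
    where
    neg : ∀ i → i ≢ 0ℤ → i * (-1ℤ * i) < 0ℤ
    neg (+ zero)     i≢0 = ⊥-elim (i≢0 refl)
    neg ℤ.+[1+ n ]   _   = ℤ.-<+
    neg ℤ.-[1+ n ]   _   = ℤ.-<+

  -- In the inductive step the remaining vectors are projected along a₀ to the hyperplane orthogonal to w.
  farkas : ∀ {n} m (a : Fin m → V n) (b : V n) →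
    (∃ λ w → (∀ k → 0ℤ ≤ dot (a k) w) × dot b w < 0ℤ) ⊎
    (Σ (Fin m → ℤ) λ c → ∃ λ p → (∀ k → 0ℤ ≤ c k) × 0ℤ < p × ∀ i → p * b i ≡ sum (λ k → c k * a k i))
  farkas zero a b with zero⊎-self-negative b
  ... | inj₁ b≡0 = inj₂ ((λ ()) , 1ℤ , (λ ()) , ℤ.+<+ (s≤s z≤n) , λ i → cong (1ℤ *_) (b≡0 i))
  ... | inj₂ neg = inj₁ ((λ i → -1ℤ * b i) , (λ ()) , neg)
  farkas (suc m) a b with farkas m (a ∘ suc) b
  ... | inj₂ (c , p , 0≤c , 0<p , eq) = inj₂ (0ℤ Vector.∷ c , p , (λ { zero → ℤ.≤-refl ; (suc k) → 0≤c k }) , 0<p ,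
          λ i → trans (eq i) (sym (trans (cong (λ z → z + sum (λ k → c k * a (suc k) i)) (ℤ.*-zeroˡ (a zero i))) (ℤ.+-identityˡ _))))
  ... | inj₁ (w , 0≤aw , bw<0) with 0ℤ ℤ.≤? dot (a zero) w
  ... | yes 0≤a₀w = inj₁ (w , (λ { zero → 0≤a₀w ; (suc k) → 0≤aw k }) , bw<0)
  ... | no ¬0≤a₀w = result (farkas m a′ b′)
    where
    a₀ = a zero
    -- Positive, since `w` fails on `a₀`; scaling by it replaces the division in the projection.
    π  = - dot a₀ w
    α  = λ k → dot (a (suc k)) w
    β  = dot b w
    a′ = λ k i → π * a (suc k) i + α k * a₀ i
    b′ = λ i → π * b i + β * a₀ i
    0<π : 0ℤ < π
    0<π = ℤ.neg-mono-< (ℤ.≰⇒> ¬0≤a₀w)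
    -- The correction of `w′` is adjoint to the projection, so a functional separating the projected
    -- vectors yields one separating the original vectors.
    project : ∀ w′ v → dot v (λ i → π * w′ i + dot a₀ w′ * w i) ≡ dot (λ i → π * v i + dot v w * a₀ i) w′
    project w′ v = trans (dot-+ʳ π (dot a₀ w′) w′ w v) (trans (cong (λ z → π * dot v w′ + z) (ℤ.*-comm (dot a₀ w′) (dot v w)))
      (sym (dot-+ˡ π (dot v w) v a₀ w′)))
    result : (∃ λ w′ → (∀ k → 0ℤ ≤ dot (a′ k) w′) × dot b′ w′ < 0ℤ) ⊎
             (Σ (Fin m → ℤ) λ c → ∃ λ p → (∀ k → 0ℤ ≤ c k) × 0ℤ < p × ∀ i → p * b′ i ≡ sum (λ k → c k * a′ k i)) → _
    result (inj₁ (w′ , 0≤a′w′ , b′w′<0)) = inj₁ (w″ , 0≤aw″ , subst (_< 0ℤ) (sym (project w′ b)) b′w′<0)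
      where
      w″ = λ i → π * w′ i + dot a₀ w′ * w i
      0≤aw″ : ∀ k → 0ℤ ≤ dot (a k) w″
      0≤aw″ zero    = ℤ.≤-reflexive (sym (trans (dot-+ʳ π (dot a₀ w′) w′ w a₀) (cancel (dot a₀ w) (dot a₀ w′))))
        where cancel : ∀ x y → - x * y + y * x ≡ 0ℤ
              cancel = ℤ.solve-∀
      0≤aw″ (suc k) = subst (0ℤ ≤_) (sym (project w′ (a (suc k)))) (0≤a′w′ k)
    result (inj₂ (c , p , 0≤c , 0<p , eq)) = inj₂ (c₀ Vector.∷ (λ k → π * c k) , π * p ,
        (λ { zero → 0≤c₀ ; (suc k) → 0≤* (ℤ.<⇒≤ 0<π) (0≤c k) }) , 0<* 0<π 0<p , eq″)
      where
      -- Undoing the projections gathers all multiples of `a₀` here. Nonnegativity uses that `w` is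
      -- nonnegative on the other generators and negative on `b`.
      c₀ = sum (λ k → c k * α k) + p * - β
      0≤sum : ∀ {m} (f : Fin m → ℤ) → (∀ k → 0ℤ ≤ f k) → 0ℤ ≤ sum f
      0≤sum {zero}  f _   = ℤ.≤-refl
      0≤sum {suc m} f 0≤f = ℤ.+-mono-≤ (0≤f zero) (0≤sum (f ∘ suc) (0≤f ∘ suc))
      0≤c₀ : 0ℤ ≤ c₀
      0≤c₀ = ℤ.+-mono-≤ (0≤sum _ (λ k → 0≤* (0≤c k) (0≤aw k))) (0≤* (ℤ.<⇒≤ 0<p) (ℤ.neg-mono-≤ (ℤ.<⇒≤ bw<0)))
      eq″ : ∀ i → π * p * b i ≡ c₀ * a₀ i + sum (λ k → π * c k * a (suc k) i)
      eq″ i = begin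
        π * p * b i
          ≡⟨ lemma₁ π p (b i) β (a₀ i) ⟩
        p * b′ i + p * - β * a₀ i
          ≡⟨ cong (λ z → z + p * - β * a₀ i) (eq i) ⟩
        sum (λ k → c k * a′ k i) + p * - β * a₀ i
          ≡⟨ cong (λ z → z + p * - β * a₀ i) (sum-cong-≗ (λ k → lemma₂ (c k) π (a (suc k) i) (α k) (a₀ i))) ⟩
        sum (λ k → c k * α k * a₀ i + π * c k * a (suc k) i) + p * - β * a₀ i
          ≡⟨ cong (λ z → z + p * - β * a₀ i) (∑-distrib-+ (λ k → c k * α k * a₀ i) (λ k → π * c k * a (suc k) i)) ⟩
        (sum (λ k → c k * α k * a₀ i) + S) + p * - β * a₀ i
          ≡⟨ cong (λ z → (z + S) + p * - β * a₀ i) (*-distribʳ-sum (a₀ i) (λ k → c k * α k)) ⟨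
        (sum (λ k → c k * α k) * a₀ i + S) + p * - β * a₀ i
          ≡⟨ lemma₃ (sum (λ k → c k * α k)) (a₀ i) S (p * - β) ⟩
        c₀ * a₀ i + S ∎
        where
        open ≡-Reasoning
        S = sum (λ k → π * c k * a (suc k) i)
        lemma₁ : ∀ π p b β a → π * p * b ≡ p * (π * b + β * a) + p * - β * a
        lemma₁ = ℤ.solve-∀
        lemma₂ : ∀ c π a α a₀ → c * (π * a + α * a₀) ≡ c * α * a₀ + π * c * a
        lemma₂ = ℤ.solve-∀
        lemma₃ : ∀ x a s y → (x * a + s) + y * a ≡ (x + y) * a + s
        lemma₃ = ℤ.solve-∀

  -- Integer solutions as rational weights; enumeration of coalitions.

  ι : ℤ → ℚ
  -- Building the fraction with denominator 1 directly lets its numerator reduce to `z`.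
  ι z = mkℚ z 0 (Coprime.sym (Coprime.1-coprimeTo ℤ.∣ z ∣))

  ι-mono-≤ : ∀ {a b} → a ≤ b → ι a ≤ℚ ι b
  ι-mono-≤ {a} {b} a≤b = *≤* (subst₂ _≤_ (sym (ℤ.*-identityʳ a)) (sym (ℤ.*-identityʳ b)) a≤b)

  ι-+ : ∀ a b → ι a +ℚ ι b ≡ ι (a + b)
  ι-+ a b = ℚ.toℚᵘ-injective (ℚᵘ.≃-trans (ℚ.toℚᵘ-homo-+ (ι a) (ι b)) (ℚᵘ.*≡* (lemma a b)))
    where lemma : ∀ a b → (a * 1ℤ + b * 1ℤ) * 1ℤ ≡ (a + b) * 1ℤ
          lemma = ℤ.solve-∀

  indicator : ∀ {n} → Subset n → V n
  indicator X i = if lookup X i then 1ℤ else 0ℤ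

  weight-ι : ∀ {n} (w : V n) X → weight (ι ∘ w) X ≡ ι (dot (indicator X) w)
  weight-ι w []      = refl
  weight-ι w (b ∷ X) = trans (cong₂ _+ℚ_ (head b) (weight-ι (w ∘ suc) X)) (ι-+ ((if b then 1ℤ else 0ℤ) * w zero) (dot (indicator X) (w ∘ suc)))
    where
    head : ∀ b → (if b then ι (w zero) else 0ℚ) ≡ ι ((if b then 1ℤ else 0ℤ) * w zero)
    head true  = cong ι (sym (ℤ.*-identityˡ (w zero)))
    head false = cong ι (sym (ℤ.*-zeroˡ (w zero)))

  subsets : ∀ n → List (Subset n)
  subsets zero    = [] ∷ []
  subsets (suc n) = List.map (true ∷_) (subsets n) ++ List.map (false ∷_) (subsets n)

  ∈-subsets : ∀ {n} (X : Subset n) → X ∈ subsets n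
  ∈-subsets []          = here refl
  ∈-subsets (true  ∷ X) = ∈-++⁺ˡ (∈-map⁺ (true ∷_) (∈-subsets X))
  ∈-subsets {suc n} (false ∷ X) = ∈-++⁺ʳ (List.map (true ∷_) (subsets n)) (∈-map⁺ (false ∷_) (∈-subsets X))

  dot-bound : ∀ {n} (u : V n) → (∀ i → u i * u i ≤ 1ℤ) → dot u u ≤ + n
  dot-bound {zero}  u _ = ℤ.≤-refl
  dot-bound {suc n} u b = ℤ.+-mono-≤ (b zero) (dot-bound (u ∘ suc) (b ∘ suc))

  basis-entry : ∀ {n} (i j : Fin n) → basis i j * basis i j ≤ 1ℤ
  basis-entry zero    zero    = ℤ.≤-refl
  basis-entry zero    (suc j) = +≤+ z≤n
  basis-entry (suc i) zero    = +≤+ z≤n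
  basis-entry (suc i) (suc j) = basis-entry i j

  ⊤-wins : ∀ {n} (G : SimpleGame n) → win G ⊤ ≡ true
  ⊤-wins G = monotone G (proj₁ (someWin G)) ⊤ (⊆-max _) (proj₂ (someWin G))

  ⊥-loses : ∀ {n} (G : SimpleGame n) → win G ⊥ ≡ false
  ⊥-loses G with win G ⊥ in eq
  ... | false = refl
  ... | true with trans (sym (monotone G ⊥ (proj₁ (someLose G)) (⊆-min _) eq)) (proj₂ (someLose G))
  ... | ()

  -- Farkas' alternative for a game: rough weights or a relation.

  module Certificates {n : ℕ} (G : SimpleGame n) where

    Coalition : Bool → Set
    Coalition b = ∃ λ X → win G X ≡ b

    Pair : Set
    Pair = Coalition true × Coalition false

    select : ∀ b → List (Subset n) → List (Coalition b)
    select b []       = []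
    select b (X ∷ Xs) with win G X Bool.≟ b
    ... | yes p = (X , p) ∷ select b Xs
    ... | no  _ = select b Xs

    ∈-select : ∀ {b X Xs} (p : win G X ≡ b) → X ∈ Xs → (X , p) ∈ select b Xs
    ∈-select {b} {X} {Y ∷ Xs} p X∈ with win G Y Bool.≟ b | X∈
    ... | yes q | here refl = here (cong (X ,_) (uip p q))
    ... | yes q | there X∈′ = there (∈-select p X∈′)
    ... | no ¬q | here refl = ⊥-elim (¬q p)
    ... | no ¬q | there X∈′ = ∈-select p X∈′

    coalitions : ∀ b → List (Coalition b)
    coalitions b = select b (subsets n)

    ∈-coalitions : ∀ {b} (X : Coalition b) → X ∈ coalitions b
    ∈-coalitions (X , p) = ∈-select p (∈-subsets X)

    -- Nonnegativity of `w` on a pair says that the losing coalition does not outweigh the winning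
    -- one; nonnegativity on `basis j` says that player `j` has nonnegative weight.
    vec : Pair ⊎ Fin n → V n
    vec (inj₁ ((X , _) , (Y , _))) i = 1ℤ * indicator X i + -1ℤ * indicator Y i
    vec (inj₂ j)                     = basis j

    generators : List (Pair ⊎ Fin n)
    generators = List.map inj₁ (List.cartesianProduct (coalitions true) (coalitions false)) ++ List.map inj₂ (List.allFin n)

    ∈-generators : ∀ g → g ∈ generators
    ∈-generators (inj₁ (X , Y)) = ∈-++⁺ˡ (∈-map⁺ inj₁ (∈-cartesianProduct⁺ (∈-coalitions X) (∈-coalitions Y)))
    ∈-generators (inj₂ i)       = ∈-++⁺ʳ (List.map inj₁ (List.cartesianProduct (coalitions true) (coalitions false))) (∈-map⁺ inj₂ (∈-allFin i))

    ones : V n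
    ones _ = 1ℤ

    vec-bound : ∀ g → dot (vec g) (vec g) ≤ + n
    vec-bound g@(inj₁ ((X , _) , (Y , _))) = dot-bound (vec g) (λ i → entry (lookup X i) (lookup Y i))
      where
      entry : ∀ a b → (1ℤ * (if a then 1ℤ else 0ℤ) + -1ℤ * (if b then 1ℤ else 0ℤ)) *
                      (1ℤ * (if a then 1ℤ else 0ℤ) + -1ℤ * (if b then 1ℤ else 0ℤ)) ≤ 1ℤ
      entry true  true  = +≤+ z≤n
      entry true  false = ℤ.≤-refl
      entry false true  = ℤ.≤-refl
      entry false false = +≤+ z≤n
    vec-bound (inj₂ j) = dot-bound (basis j) (basis-entry j)

    -- The quota is the largest weight of a losing coalition, which no winning coalition undercuts.
    -- The last hypothesis makes the total weight positive, so the weights are not all zero.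
    separated⇒roughlyWeighted : (w : V n) → (∀ g → 0ℤ ≤ dot (vec g) w) → dot (λ _ → -1ℤ) w < 0ℤ → RoughlyWeighted G
    separated⇒roughlyWeighted w 0≤ neg = ι ∘ w , q , (λ i → ι-mono-≤ (subst (0ℤ ≤_) (dot-basis i w) (0≤ (inj₂ i)))) , nontrivial , light⇒loses , heavy⇒wins
      where
      value : Subset n → ℤ
      value X = dot (indicator X) w
      heaviest : Coalition false
      -- The default of `argmax` competes for the maximum, so it too must be a losing coalition.
      heaviest = argmax (value ∘ proj₁) (someLose G) (coalitions false)
      q : ℚ
      q = ι (value (proj₁ heaviest))
      nontrivial : ¬ ((∀ i → ι (w i) ≡ 0ℚ) × q ≡ 0ℚ)
      nontrivial (w≡0 , _) = ℤ.<-irrefl (sum-zero (λ i → cong (-1ℤ *_) (cong ℚ.numerator (w≡0 i)))) neg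
      lose≤win : ∀ X Y → win G X ≡ true → win G Y ≡ false → value Y ≤ value X
      lose≤win X Y X-wins Y-loses = ℤ.0≤i-j⇒j≤i (subst (0ℤ ≤_)
        (trans (dot-+ˡ 1ℤ -1ℤ (indicator X) (indicator Y) w) (lemma (value X) (value Y)))
        (0≤ (inj₁ ((X , X-wins) , (Y , Y-loses)))))
        where lemma : ∀ a b → 1ℤ * a + -1ℤ * b ≡ a + - b
              lemma = ℤ.solve-∀
      light⇒loses : ∀ X → weight (ι ∘ w) X <ℚ q → win G X ≡ false
      light⇒loses X X<q with win G X in eq
      ... | false = refl
      ... | true  = ⊥-elim (ℚ.<-irrefl refl (ℚ.<-≤-trans X<q (subst (q ≤ℚ_) (sym (weight-ι w X)) (ι-mono-≤ (lose≤win X (proj₁ heaviest) eq (proj₂ heaviest))))))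
      heavy⇒wins : ∀ X → q <ℚ weight (ι ∘ w) X → win G X ≡ true
      heavy⇒wins X q<X with win G X in eq
      ... | true  = refl
      ... | false = ⊥-elim (ℚ.<-irrefl refl (ℚ.<-≤-trans q<X (subst (_≤ℚ q) (sym (weight-ι w X)) (ι-mono-≤
            (All.lookup (f[xs]≤f[argmax] {f = value ∘ proj₁} (someLose G) (coalitions false)) (∈-coalitions (X , eq)))))))

    -- Without rough weights, `farkas` puts a positive multiple p of the vector -1 into the cone of
    -- the generators. Moved to the other side, p is the positive coefficient of `ones`.
    ¬roughlyWeighted⇒circuit : ¬ RoughlyWeighted G → ∃ λ m → Σ (Fin m → Pair ⊎ Fin n) λ g → Circuit n ones (vec ∘ g)
    ¬roughlyWeighted⇒circuit ¬rw with farkas (length generators) (vec ∘ List.lookup generators) (λ _ → -1ℤ)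
    ... | inj₁ (w , 0≤ , neg) = ⊥-elim (¬rw (separated⇒roughlyWeighted w (λ g → subst (λ h → 0ℤ ≤ dot (vec h) w) (sym (lookup-index (∈-generators g))) (0≤ (index (∈-generators g)))) neg))
    ... | inj₂ (c , p , 0≤c , 0<p , eq) = circuit n ones vec (dot-bound ones (λ _ → ℤ.≤-refl)) vec-bound (length generators) (List.lookup generators)
      (p Vector.∷ c) ((λ { zero → ℤ.<⇒≤ 0<p ; (suc k) → 0≤c k }) , 0<p , λ i → trans (cong (λ z → p * 1ℤ + z) (sym (eq i))) (lemma p))
      where lemma : ∀ p → p * 1ℤ + p * -1ℤ ≡ 0ℤ
            lemma = ℤ.solve-∀

    -- From a relation to a potent certificate.

    winCount loseCount : List Pair → Fin n → ℕ
    winCount  []                    i = 0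
    winCount  (((X , _) , _) ∷ L) i = bit (lookup X i) ℕ.+ winCount L i
    loseCount []                    i = 0
    loseCount ((_ , (Y , _)) ∷ L)   i = bit (lookup Y i) ℕ.+ loseCount L i

    winCount≤length : ∀ L i → winCount L i ℕ.≤ length L
    winCount≤length []      i = z≤n
    winCount≤length (((X , _) , _) ∷ L) i with lookup X i
    ... | true  = s≤s (winCount≤length L i)
    ... | false = ℕ.m≤n⇒m≤1+n (winCount≤length L i)

    loseCount≤length : ∀ L i → loseCount L i ℕ.≤ length L
    loseCount≤length []      i = z≤n
    loseCount≤length ((_ , (Y , _)) ∷ L) i with lookup Y i
    ... | true  = s≤s (loseCount≤length L i)
    ... | false = ℕ.m≤n⇒m≤1+n (loseCount≤length L i)

    enlarge : Subset n → (Fin n → ℕ) → Subset n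
    enlarge X δ = Vec.tabulate (λ i → lookup X i ∨ (0 ℕ.<ᵇ δ i))

    ⊆-enlarge : ∀ X δ → X ⊆ enlarge X δ
    ⊆-enlarge X δ {i} i∈X = Vec.lookup⇒[]= i (enlarge X δ)
      (trans (Vec.lookup∘tabulate _ i) (cong (_∨ (0 ℕ.<ᵇ δ i)) (Vec.[]=⇒lookup i∈X)))

    -- Adds player i greedily to the first δ i winning coalitions that lack it.
    raise : List Pair → (Fin n → ℕ) → List Pair
    raise []                    δ = []
    raise (((X , p) , Y) ∷ L) δ = ((enlarge X δ , monotone G X _ (⊆-enlarge X δ) p) , Y) ∷
                                    raise L (λ i → if lookup X i then δ i else ℕ.pred (δ i))

    length-raise : ∀ L δ → length (raise L δ) ≡ length L
    length-raise []      δ = refl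
    length-raise (_ ∷ L) δ = cong suc (length-raise L _)

    loseCount-raise : ∀ L δ i → loseCount (raise L δ) i ≡ loseCount L i
    loseCount-raise []                  δ i = refl
    loseCount-raise ((_ , (Y , _)) ∷ L) δ i = cong (bit (lookup Y i) ℕ.+_) (loseCount-raise L _ i)

    -- The hypothesis says that at least `δ i` winning coalitions of the list lack player `i`, so
    -- the greedy insertion uses up its whole budget.
    winCount-raise : ∀ L δ i → winCount L i ℕ.+ δ i ℕ.≤ length L → winCount (raise L δ) i ≡ winCount L i ℕ.+ δ i
    winCount-raise []                    δ i h = sym (ℕ.n≤0⇒n≡0 h)
    winCount-raise (((X , _) , _) ∷ L) δ i h =
      trans (cong₂ (λ a b → bit a ℕ.+ b) (Vec.lookup∘tabulate _ i) refl)
            (step (lookup X i) (δ i) refl refl h)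
      where
      δ′ = λ i → if lookup X i then δ i else ℕ.pred (δ i)
      step : ∀ b d → lookup X i ≡ b → δ i ≡ d → bit b ℕ.+ winCount L i ℕ.+ d ℕ.≤ suc (length L) →
        bit (b ∨ (0 ℕ.<ᵇ d)) ℕ.+ winCount (raise L δ′) i ≡ bit b ℕ.+ winCount L i ℕ.+ d
      step true d eb ed h = cong suc (trans (winCount-raise L δ′ i (subst (λ z → winCount L i ℕ.+ z ℕ.≤ length L) (sym δ′≡) (s≤s⁻¹ h))) (cong (winCount L i ℕ.+_) δ′≡))
        where δ′≡ : δ′ i ≡ d
              δ′≡ = trans (cong (λ b → if b then δ i else ℕ.pred (δ i)) eb) ed
      -- Here `h` only bounds the count by `suc (length L)`, one too much for the induction; with
      -- nothing left to insert, the trivial bound serves instead.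
      step false zero eb ed h = trans (winCount-raise L δ′ i (subst (λ z → winCount L i ℕ.+ z ℕ.≤ length L) (sym δ′≡)
          (ℕ.≤-trans (ℕ.≤-reflexive (ℕ.+-identityʳ _)) (winCount≤length L i)))) (cong (winCount L i ℕ.+_) δ′≡)
        where δ′≡ : δ′ i ≡ 0
              δ′≡ = trans (cong (λ b → if b then δ i else ℕ.pred (δ i)) eb) (cong ℕ.pred ed)
      step false (suc d) eb ed h = trans (cong suc (trans (winCount-raise L δ′ i (subst (λ z → winCount L i ℕ.+ z ℕ.≤ length L) (sym δ′≡)
          (s≤s⁻¹ (subst (ℕ._≤ suc (length L)) (ℕ.+-suc _ d) h)))) (cong (winCount L i ℕ.+_) δ′≡))) (sym (ℕ.+-suc _ d))
        where δ′≡ : δ′ i ≡ d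
              δ′≡ = trans (cong (λ b → if b then δ i else ℕ.pred (δ i)) eb) (cong ℕ.pred ed)

    sumℕ : ∀ {m} → (Fin m → ℕ) → ℕ
    sumℕ {zero}  f = 0
    sumℕ {suc m} f = f zero ℕ.+ sumℕ (f ∘ suc)

    -- Coefficients of pairs become repetitions; those of unit vectors are collected in `slack`, the
    -- number of places each player still has to receive in winning coalitions. Only the former
    -- contribute to the length.
    record Expansion {m} (g : Fin m → Pair ⊎ Fin n) (ν : Fin m → ℕ) : Set where
      field
        pairs   : List Pair
        slack   : Fin n → ℕ
        length≤ : length pairs ℕ.≤ sumℕ ν
        total   : ∀ i → sum (λ k → + ν k * vec (g k) i) ≡ + winCount pairs i + + slack i + - (+ loseCount pairs i)
    open Expansion

    repeat : ℕ → Pair → List Pair → List Pair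
    repeat k p L = List.replicate k p ++ L

    length-repeat : ∀ k p L → length (repeat k p L) ≡ k ℕ.+ length L
    length-repeat zero    p L = refl
    length-repeat (suc k) p L = cong suc (length-repeat k p L)

    winCount-repeat : ∀ k p L i → winCount (repeat k p L) i ≡ k ℕ.* bit (lookup (proj₁ (proj₁ p)) i) ℕ.+ winCount L i
    winCount-repeat zero    p L i = refl
    winCount-repeat (suc k) p L i = trans (cong (bit (lookup (proj₁ (proj₁ p)) i) ℕ.+_) (winCount-repeat k p L i)) (sym (ℕ.+-assoc (bit (lookup (proj₁ (proj₁ p)) i)) _ _))

    loseCount-repeat : ∀ k p L i → loseCount (repeat k p L) i ≡ k ℕ.* bit (lookup (proj₁ (proj₂ p)) i) ℕ.+ loseCount L i
    loseCount-repeat zero    p L i = refl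
    loseCount-repeat (suc k) p L i = trans (cong (bit (lookup (proj₁ (proj₂ p)) i) ℕ.+_) (loseCount-repeat k p L i)) (sym (ℕ.+-assoc (bit (lookup (proj₁ (proj₂ p)) i)) _ _))

    indicator-bit : ∀ b → (if b then 1ℤ else 0ℤ) ≡ + bit b
    indicator-bit true  = refl
    indicator-bit false = refl

    unitVector : Fin n → Fin n → ℕ
    unitVector j i = ℤ.∣ basis j i ∣

    0≤basis : ∀ {n} (j i : Fin n) → 0ℤ ≤ basis j i
    0≤basis zero    zero    = +≤+ z≤n
    0≤basis zero    (suc i) = +≤+ z≤n
    0≤basis (suc j) zero    = +≤+ z≤n
    0≤basis (suc j) (suc i) = 0≤basis j i

    expand : ∀ {m} (g : Fin m → Pair ⊎ Fin n) ν → Expansion g ν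
    expand {zero}  g ν = record { pairs = [] ; slack = λ _ → 0 ; length≤ = z≤n ; total = λ i → refl }
    expand {suc m} g ν with g zero in g₀ | expand (g ∘ suc) (ν ∘ suc)
    ... | inj₁ p@((X , _) , (Y , _)) | E = record
      { pairs   = repeat (ν zero) p (pairs E)
      ; slack   = slack E
      ; length≤ = ℕ.≤-trans (ℕ.≤-reflexive (length-repeat (ν zero) p (pairs E))) (ℕ.+-monoʳ-≤ (ν zero) (length≤ E))
      ; total   = λ i → begin
          + ν zero * vec (g zero) i + sum (λ k → + ν (suc k) * vec (g (suc k)) i)
            ≡⟨ cong₂ (λ a b → + ν zero * vec a i + b) g₀ (total E i) ⟩
          + ν zero * (1ℤ * indicator X i + -1ℤ * indicator Y i) + (+ winCount (pairs E) i + + slack E i + - (+ loseCount (pairs E) i))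
            ≡⟨ cong₂ (λ a b → + ν zero * (1ℤ * a + -1ℤ * b) + (+ winCount (pairs E) i + + slack E i + - (+ loseCount (pairs E) i)))
                 (indicator-bit (lookup X i)) (indicator-bit (lookup Y i)) ⟩
          + ν zero * (1ℤ * + bit (lookup X i) + -1ℤ * + bit (lookup Y i)) + (+ winCount (pairs E) i + + slack E i + - (+ loseCount (pairs E) i))
            ≡⟨ lemma (+ ν zero) (+ bit (lookup X i)) (+ bit (lookup Y i)) (+ winCount (pairs E) i) (+ slack E i) (+ loseCount (pairs E) i) ⟩
          (+ ν zero * + bit (lookup X i) + + winCount (pairs E) i) + + slack E i + - (+ ν zero * + bit (lookup Y i) + + loseCount (pairs E) i)
            ≡⟨ cong₂ (λ a b → a + + slack E i + - b)
                 (cast (ν zero) (bit (lookup X i)) (winCount (pairs E) i) (winCount-repeat (ν zero) p (pairs E) i))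
                 (cast (ν zero) (bit (lookup Y i)) (loseCount (pairs E) i) (loseCount-repeat (ν zero) p (pairs E) i)) ⟩
          + winCount (repeat (ν zero) p (pairs E)) i + + slack E i + - (+ loseCount (repeat (ν zero) p (pairs E)) i) ∎
      }
      where
      open ≡-Reasoning
      lemma : ∀ v x y a s b → v * (1ℤ * x + -1ℤ * y) + (a + s + - b) ≡ (v * x + a) + s + - (v * y + b)
      lemma = ℤ.solve-∀
      cast : ∀ a b c {d} → d ≡ a ℕ.* b ℕ.+ c → + a * + b + + c ≡ + d
      cast a b c refl = trans (cong (_+ + c) (sym (ℤ.pos-* a b))) (sym (ℤ.pos-+ (a ℕ.* b) c))
    ... | inj₂ j | E = record
      { pairs   = pairs E
      ; slack   = λ i → ν zero ℕ.* unitVector j i ℕ.+ slack E i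
      ; length≤ = ℕ.≤-trans (length≤ E) (ℕ.m≤n+m _ (ν zero))
      ; total   = λ i → begin
          + ν zero * vec (g zero) i + sum (λ k → + ν (suc k) * vec (g (suc k)) i)
            ≡⟨ cong₂ (λ a b → + ν zero * vec a i + b) g₀ (total E i) ⟩
          + ν zero * basis j i + (+ winCount (pairs E) i + + slack E i + - (+ loseCount (pairs E) i))
            ≡⟨ cong (λ z → + ν zero * z + (+ winCount (pairs E) i + + slack E i + - (+ loseCount (pairs E) i))) (ℤ.0≤i⇒+∣i∣≡i (0≤basis j i)) ⟨
          + ν zero * + unitVector j i + (+ winCount (pairs E) i + + slack E i + - (+ loseCount (pairs E) i))
            ≡⟨ lemma (+ ν zero * + unitVector j i) (+ winCount (pairs E) i) (+ slack E i) (+ loseCount (pairs E) i) ⟩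
          + winCount (pairs E) i + (+ ν zero * + unitVector j i + + slack E i) + - (+ loseCount (pairs E) i)
            ≡⟨ cong (λ z → + winCount (pairs E) i + z + - (+ loseCount (pairs E) i))
                 (trans (cong (_+ + slack E i) (sym (ℤ.pos-* (ν zero) (unitVector j i)))) (sym (ℤ.pos-+ (ν zero ℕ.* unitVector j i) (slack E i)))) ⟩
          + winCount (pairs E) i + + (ν zero ℕ.* unitVector j i ℕ.+ slack E i) + - (+ loseCount (pairs E) i) ∎
      }
      where
      open ≡-Reasoning
      lemma : ∀ x a s b → x + (a + s + - b) ≡ a + (x + s) + - b
      lemma = ℤ.solve-∀

    grand : Pair
    grand = (⊤ , ⊤-wins G) , (⊥ , ⊥-loses G)

    -- The witness is the largest value of `f`; it replaces the square root of `B`.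
    sumℕ-squared : ∀ {m} B (f : Fin m → ℕ) → (∀ k → f k ℕ.* f k ℕ.≤ B) → ∃ λ M → M ℕ.* M ℕ.≤ B × sumℕ f ℕ.≤ m ℕ.* M
    sumℕ-squared {zero}  B f b = 0 , z≤n , z≤n
    sumℕ-squared {suc m} B f b with sumℕ-squared B (f ∘ suc) (b ∘ suc)
    ... | M , M²≤B , Σ≤ with ℕ.≤-total (f zero) M
    ... | inj₁ f₀≤M = M , M²≤B , ℕ.+-mono-≤ f₀≤M Σ≤
    ... | inj₂ M≤f₀ = f zero , b zero , ℕ.+-monoʳ-≤ (f zero) (ℕ.≤-trans Σ≤ (ℕ.*-monoʳ-≤ m M≤f₀))

    mult-win : ∀ L i → mult (λ k → proj₁ (proj₁ (List.lookup L k))) i ≡ winCount L i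
    mult-win []      i = refl
    mult-win (((X , _) , _) ∷ L) i = cong (bit (lookup X i) ℕ.+_) (mult-win L i)

    mult-lose : ∀ L i → mult (λ k → proj₁ (proj₂ (List.lookup L k))) i ≡ loseCount L i
    mult-lose []      i = refl
    mult-lose ((_ , (Y , _)) ∷ L) i = cong (bit (lookup Y i) ℕ.+_) (mult-lose L i)

    transform : (L : List Pair) → (∀ i → winCount L i ≡ loseCount L i) → TradingTransform n (length L)
    transform L eq = record
      { xs       = λ k → proj₁ (proj₁ (List.lookup L k))
      ; ys       = λ k → proj₁ (proj₂ (List.lookup L k))
      ; balanced = λ i → trans (mult-win L i) (trans (eq i) (sym (mult-lose L i)))
      }

    enlarge-⊤ : ∀ δ → enlarge ⊤ δ ≡ ⊤
    enlarge-⊤ δ = trans (Vec.tabulate-cong (λ i → trans (cong (_∨ (0 ℕ.<ᵇ δ i)) (Vec.lookup-replicate i true)) (sym (Vec.lookup-replicate i true)))) (Vec.tabulate∘lookup ⊤)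

    -- Raising keeps `grand` at the head: its winning coalition is already full, and losing
    -- coalitions are not touched. There is room for the slack because a player occurs in at most
    -- `length` many losing coalitions.
    potent : ∀ (L : List Pair) δ → (∀ i → winCount (grand ∷ L) i ℕ.+ δ i ≡ loseCount (grand ∷ L) i) →
      Σ (TradingTransform n (suc (length L))) λ T → IsPotentCertificate G T
    potent L δ eq = subst (λ j → Σ (TradingTransform n j) λ T → IsPotentCertificate G T) (length-raise (grand ∷ L) δ)
      (transform L′ balanced′ , ((λ k → proj₂ (proj₁ (List.lookup L′ k))) , (λ k → proj₂ (proj₂ (List.lookup L′ k)))) ,
        (zero , enlarge-⊤ δ) , (zero , refl))
      where
      L′ = raise (grand ∷ L) δ
      balanced′ : ∀ i → winCount L′ i ≡ loseCount L′ i
      balanced′ i = begin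
        winCount L′ i                        ≡⟨ winCount-raise (grand ∷ L) δ i (subst (ℕ._≤ suc (length L)) (sym (eq i)) (loseCount≤length (grand ∷ L) i)) ⟩
        winCount (grand ∷ L) i ℕ.+ δ i       ≡⟨ eq i ⟩
        loseCount (grand ∷ L) i              ≡⟨ loseCount-raise (grand ∷ L) δ i ⟨
        loseCount L′ i                       ∎
        where open ≡-Reasoning

    -- The length is at most the sum of the `suc m` coefficients, whose squares are at most n^m. As
    -- m ≤ n and n is positive, n^m is at most n^n, the square of 2^(½ n log₂ n).
    upper-bound : .{{_ : ℕ.NonZero n}} → ¬ RoughlyWeighted G →
      Σ ℕ λ j → Σ (TradingTransform n j) λ T → IsPotentCertificate G T × (j ℕ.* j ℕ.≤ (suc n ℕ.* suc n) ℕ.* n ℕ.^ n)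
    upper-bound ¬rw with ¬roughlyWeighted⇒circuit ¬rw
    ... | m , g , cir = assemble (coeff cir zero) (0<coeff₀ cir) refl
      where
      E = expand g (coeff cir ∘ suc)
      assemble : ∀ d → 0 ℕ.< d → coeff cir zero ≡ d → _
      -- One of the `suc d` copies of `grand` is split off as the head that `potent` expects.
      assemble (suc d) _ d≡ = suc (length L) , proj₁ certificate , proj₂ certificate , bound
        where
        L = repeat d grand (pairs E)
        balance : ∀ i → winCount (repeat (suc d) grand (pairs E)) i ℕ.+ slack E i ≡ loseCount (repeat (suc d) grand (pairs E)) i
        balance i = ℤ.+-injective (begin
          + (winCount (repeat (suc d) grand (pairs E)) i ℕ.+ slack E i)
            ≡⟨ cong (λ z → + (z ℕ.+ slack E i)) (trans (winCount-repeat (suc d) grand (pairs E) i)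
                 (cong (ℕ._+ winCount (pairs E) i) (trans (cong (λ b → suc d ℕ.* bit b) (Vec.lookup-replicate i true)) (ℕ.*-identityʳ (suc d))))) ⟩
          + (suc d ℕ.+ winCount (pairs E) i ℕ.+ slack E i)
            ≡⟨ lemma (+ suc d) (+ winCount (pairs E) i) (+ slack E i) (+ loseCount (pairs E) i) ⟩
          + suc d * 1ℤ + (+ winCount (pairs E) i + + slack E i + - (+ loseCount (pairs E) i)) + + loseCount (pairs E) i
            ≡⟨ cong (_+ + loseCount (pairs E) i) (trans (cong₂ (λ a b → + a * 1ℤ + b) (sym d≡) (sym (total E i))) (dependency cir i)) ⟩
          0ℤ + + loseCount (pairs E) i
            ≡⟨ cong +_ (sym (trans (loseCount-repeat (suc d) grand (pairs E) i)
                 (cong (ℕ._+ loseCount (pairs E) i) (trans (cong (λ b → suc d ℕ.* bit b) (Vec.lookup-replicate i false)) (ℕ.*-zeroʳ (suc d)))))) ⟩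
          + loseCount (repeat (suc d) grand (pairs E)) i ∎)
          where
          open ≡-Reasoning
          lemma : ∀ d x s y → d + x + s ≡ d * 1ℤ + (x + s + - y) + y
          lemma = ℤ.solve-∀
        certificate = potent L (slack E) balance
        bound : suc (length L) ℕ.* suc (length L) ℕ.≤ (suc n ℕ.* suc n) ℕ.* n ℕ.^ n
        bound with sumℕ-squared (n ℕ.^ m) (coeff cir) (coeff²≤ cir)
        ... | M , M²≤ , Σ≤ = begin
          suc (length L) ℕ.* suc (length L)      ≤⟨ ℕ.*-mono-≤ j≤ j≤ ⟩
          (suc n ℕ.* M) ℕ.* (suc n ℕ.* M)        ≡⟨ ℕ.[m*n]*[o*p]≡[m*o]*[n*p] (suc n) M (suc n) M ⟩
          (suc n ℕ.* suc n) ℕ.* (M ℕ.* M)        ≤⟨ ℕ.*-monoʳ-≤ (suc n ℕ.* suc n) (ℕ.≤-trans M²≤ (ℕ.^-monoʳ-≤ n (m≤n cir))) ⟩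
          (suc n ℕ.* suc n) ℕ.* n ℕ.^ n          ∎
          where
          open ℕ.≤-Reasoning
          j≤ : suc (length L) ℕ.≤ suc n ℕ.* M
          j≤ = begin
            suc (length L)                              ≡⟨ cong suc (length-repeat d grand (pairs E)) ⟩
            suc d ℕ.+ length (pairs E)                  ≤⟨ ℕ.+-monoʳ-≤ (suc d) (length≤ E) ⟩
            suc d ℕ.+ sumℕ (coeff cir ∘ suc)            ≡⟨ cong (ℕ._+ sumℕ (coeff cir ∘ suc)) d≡ ⟨
            sumℕ (coeff cir)                            ≤⟨ Σ≤ ⟩
            suc m ℕ.* M                                 ≤⟨ ℕ.*-monoˡ-≤ M (s≤s (m≤n cir)) ⟩
            suc n ℕ.* M                                 ∎

-- Lower bound: counting points in a trading transform.

module LowerBound where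

  open import Algebra.Properties.Semiring.Sum ℕ.+-*-semiring
  open import Data.Bool using (_∧_)
  open import Data.Nat using (_+_; _*_; _≤_; _≤ᵇ_; _≤?_)

  score : ∀ {n} → (Fin n → ℕ) → Subset n → ℕ
  score v X = sum (λ i → v i * bit (lookup X i))

  mult-sum : ∀ {j n} (Xs : Fin j → Subset n) i → mult Xs i ≡ sum (λ k → bit (lookup (Xs k) i))
  mult-sum {zero}  Xs i = refl
  mult-sum {suc j} Xs i = cong (bit (lookup (Xs zero) i) +_) (mult-sum (Xs ∘ suc) i)

  -- Double counting: the total depends only on multiplicities, so both sides of a trading transform
  -- have the same total.
  sum-score : ∀ {j n} (v : Fin n → ℕ) (Xs : Fin j → Subset n) → sum (λ k → score v (Xs k)) ≡ sum (λ i → v i * mult Xs i)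
  sum-score v Xs = trans (∑-comm (λ k i → v i * bit (lookup (Xs k) i)))
    (sum-cong-≗ (λ i → trans (sym (*-distribˡ-sum (v i) (λ k → bit (lookup (Xs k) i)))) (cong (v i *_) (sym (mult-sum Xs i)))))

  sum-mono-≤ : ∀ {n} {f g : Fin n → ℕ} → (∀ i → f i ≤ g i) → sum f ≤ sum g
  sum-mono-≤ {zero}  f≤g = z≤n
  sum-mono-≤ {suc n} f≤g = ℕ.+-mono-≤ (f≤g zero) (sum-mono-≤ (f≤g ∘ suc))

  ⊆⇒lookup : ∀ {n} {X Y : Subset n} → X ⊆ Y → ∀ i → lookup X i ≡ true → lookup Y i ≡ true
  ⊆⇒lookup {X = X} X⊆Y i p = Vec.[]=⇒lookup (X⊆Y (Vec.lookup⇒[]= i X p))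

  bit-mono : ∀ a b → (a ≡ true → b ≡ true) → bit a ≤ bit b
  bit-mono false b f = z≤n
  bit-mono true  b f rewrite f refl = ℕ.≤-refl

  score-mono : ∀ {n} (v : Fin n → ℕ) {X Y : Subset n} → X ⊆ Y → score v X ≤ score v Y
  score-mono v X⊆Y = sum-mono-≤ (λ i → ℕ.*-monoʳ-≤ (v i) (bit-mono _ _ (⊆⇒lookup X⊆Y i)))

  score-⊤ : ∀ {n} (v : Fin n → ℕ) → score v ⊤ ≡ sum v
  score-⊤ v = sum-cong-≗ (λ i → trans (cong (λ b → v i * bit b) (Vec.lookup-replicate i true)) (ℕ.*-identityʳ (v i)))

  score-⊥ : ∀ {n} (v : Fin n → ℕ) → score v ⊥ ≡ 0
  score-⊥ {n} v = trans (sum-cong-≗ (λ i → trans (cong (λ b → v i * bit b) (Vec.lookup-replicate i false)) (ℕ.*-zeroʳ (v i)))) (sum-replicate-zero n)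

  score-⁅⁆ : ∀ {n} (v : Fin n → ℕ) i → score v ⁅ i ⁆ ≡ v i
  score-⁅⁆ v zero    = trans (cong₂ _+_ (ℕ.*-identityʳ (v zero)) (score-⊥ (v ∘ suc))) (ℕ.+-identityʳ (v zero))
  score-⁅⁆ v (suc i) = cong₂ _+_ (ℕ.*-zeroʳ (v zero)) (score-⁅⁆ (v ∘ suc) i)

  -- One term is kept exactly and the other j - 1 are estimated by `a`; the extra `a` on the right
  -- avoids the subtraction.
  sum-lower : ∀ {j} (f : Fin j → ℕ) a → (∀ k → a ≤ f k) → ∀ k → f k + a * j ≤ sum f + a
  sum-lower {suc j} f a a≤ zero = begin
    f zero + a * suc j            ≡⟨ lemma (f zero) a j ⟩
    f zero + j * a + a            ≤⟨ ℕ.+-monoˡ-≤ a (ℕ.+-monoʳ-≤ (f zero) (bound (f ∘ suc) (a≤ ∘ suc))) ⟩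
    f zero + sum (f ∘ suc) + a    ∎
    where
    open ℕ.≤-Reasoning
    lemma : ∀ x a j → x + a * suc j ≡ x + j * a + a
    lemma = ℕ.solve-∀
    bound : ∀ {j} (f : Fin j → ℕ) → (∀ k → a ≤ f k) → j * a ≤ sum f
    bound {zero}  f _  = z≤n
    bound {suc j} f a≤ = ℕ.+-mono-≤ (a≤ zero) (bound (f ∘ suc) (a≤ ∘ suc))
  sum-lower {suc j} f a a≤ (suc k) = begin
    f (suc k) + a * suc j              ≡⟨ lemma (f (suc k)) a j ⟩
    a + (f (suc k) + a * j)            ≤⟨ ℕ.+-mono-≤ (a≤ zero) (sum-lower (f ∘ suc) a (a≤ ∘ suc) k) ⟩
    f zero + (sum (f ∘ suc) + a)       ≡⟨ ℕ.+-assoc (f zero) _ a ⟨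
    f zero + sum (f ∘ suc) + a         ∎
    where
    open ℕ.≤-Reasoning
    lemma : ∀ x a j → x + a * suc j ≡ a + (x + a * j)
    lemma = ℕ.solve-∀

  sum-upper : ∀ {j} (f : Fin j → ℕ) b → (∀ k → f k ≤ b) → ∀ k → sum f + b ≤ f k + b * j
  sum-upper {suc j} f b ≤b zero = begin
    f zero + sum (f ∘ suc) + b    ≤⟨ ℕ.+-monoˡ-≤ b (ℕ.+-monoʳ-≤ (f zero) (bound (f ∘ suc) (≤b ∘ suc))) ⟩
    f zero + j * b + b            ≡⟨ lemma (f zero) b j ⟨
    f zero + b * suc j            ∎
    where
    open ℕ.≤-Reasoning
    lemma : ∀ x a j → x + a * suc j ≡ x + j * a + a
    lemma = ℕ.solve-∀
    bound : ∀ {j} (f : Fin j → ℕ) → (∀ k → f k ≤ b) → sum f ≤ j * b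
    bound {zero}  f _  = z≤n
    bound {suc j} f ≤b = ℕ.+-mono-≤ (≤b zero) (bound (f ∘ suc) (≤b ∘ suc))
  sum-upper {suc j} f b ≤b (suc k) = begin
    f zero + sum (f ∘ suc) + b         ≡⟨ ℕ.+-assoc (f zero) _ b ⟩
    f zero + (sum (f ∘ suc) + b)       ≤⟨ ℕ.+-mono-≤ (≤b zero) (sum-upper (f ∘ suc) b (≤b ∘ suc) k) ⟩
    b + (f (suc k) + b * j)            ≡⟨ lemma (f (suc k)) b j ⟨
    f (suc k) + b * suc j              ∎
    where
    open ℕ.≤-Reasoning
    lemma : ∀ x a j → x + a * suc j ≡ a + (x + a * j)
    lemma = ℕ.solve-∀

  -- The game and the range of points of its coalitions.

  ∨-true : ∀ {a b} → a ∨ b ≡ true → a ≡ true ⊎ b ≡ true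
  ∨-true {true}  _ = inj₁ refl
  ∨-true {false} p = inj₂ p

  points : ∀ {m} → Fin (5 + m) → ℕ
  points zero          = 3
  points (suc zero)    = 3
  points (suc (suc i)) = 2

  core : ∀ {m} → Subset (5 + m) → Bool
  core (a ∷ b ∷ c ∷ d ∷ e ∷ _) = (a ∧ b) ∨ (c ∧ d ∧ e)

  wins : ∀ {m} → Subset (5 + m) → Bool
  wins X = (8 ≤ᵇ score points X) ∨ core X

  core-mono : ∀ {m} {X Y : Subset (5 + m)} → X ⊆ Y → core X ≡ true → core Y ≡ true
  core-mono {X = a ∷ b ∷ c ∷ d ∷ e ∷ X} {a′ ∷ b′ ∷ c′ ∷ d′ ∷ e′ ∷ Y} X⊆Y p with ∨-true {a ∧ b} p
  ... | inj₁ ab = cong₂ (λ x y → x ∧ y ∨ (c′ ∧ d′ ∧ e′)) (⊆⇒lookup X⊆Y 0F (Bool.∧-conicalˡ a b ab)) (⊆⇒lookup X⊆Y 1F (Bool.∧-conicalʳ a b ab))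
  ... | inj₂ cde = trans (cong (λ z → (a′ ∧ b′) ∨ z) (cong₂ _∧_ (⊆⇒lookup X⊆Y 2F (Bool.∧-conicalˡ c _ cde))
      (cong₂ _∧_ (⊆⇒lookup X⊆Y 3F (Bool.∧-conicalˡ d e de)) (⊆⇒lookup X⊆Y 4F (Bool.∧-conicalʳ d e de)))))
      (Bool.∨-zeroʳ (a′ ∧ b′))
    where de = Bool.∧-conicalʳ c _ cde

  ≤⇒≤ᵇ≡true : ∀ {a b} → a ≤ b → (a ≤ᵇ b) ≡ true
  ≤⇒≤ᵇ≡true {a} {b} a≤b with a ≤ᵇ b | ℕ.≤⇒≤ᵇ a≤b
  ... | true | _ = refl

  ≤ᵇ≡true⇒≤ : ∀ {a b} → (a ≤ᵇ b) ≡ true → a ≤ b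
  ≤ᵇ≡true⇒≤ {a} {b} p = ℕ.≤ᵇ⇒≤ a b (subst T (sym p) _)

  wins-mono : ∀ {m} (X Y : Subset (5 + m)) → X ⊆ Y → wins X ≡ true → wins Y ≡ true
  wins-mono X Y X⊆Y p with ∨-true {8 ≤ᵇ score points X} p
  ... | inj₁ heavy = cong (_∨ core Y) (≤⇒≤ᵇ≡true (ℕ.≤-trans (≤ᵇ≡true⇒≤ {8} heavy) (score-mono points X⊆Y)))
  ... | inj₂ c     = trans (cong ((8 ≤ᵇ score points Y) ∨_) (core-mono X⊆Y c)) (Bool.∨-zeroʳ (8 ≤ᵇ score points Y))

  wins⇒6≤score : ∀ {m} (X : Subset (5 + m)) → wins X ≡ true → 6 ≤ score points X
  wins⇒6≤score X p with ∨-true {8 ≤ᵇ score points X} p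
  ... | inj₁ heavy = ℕ.≤-trans (ℕ.m≤m+n 6 2) (≤ᵇ≡true⇒≤ {8} heavy)
  wins⇒6≤score (a ∷ b ∷ c ∷ d ∷ e ∷ X) p | inj₂ q with ∨-true {a ∧ b} q
  wins⇒6≤score (true ∷ true ∷ c ∷ d ∷ e ∷ X) p | inj₂ q | inj₁ refl = ℕ.m≤m+n 6 _
  wins⇒6≤score (a ∷ b ∷ true ∷ true ∷ true ∷ X) p | inj₂ q | inj₂ refl = ℕ.m≤n⇒m≤o+n (3 * bit a) (ℕ.m≤n⇒m≤o+n (3 * bit b) (ℕ.m≤m+n 6 _))

  loses⇒score≤7 : ∀ {m} (X : Subset (5 + m)) → wins X ≡ false → score points X ≤ 7
  loses⇒score≤7 X p with 8 ≤? score points X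
  ... | no ¬8≤ = s≤s⁻¹ (ℕ.≰⇒> ¬8≤)
  ... | yes 8≤ with trans (sym p) (cong (_∨ core X) (≤⇒≤ᵇ≡true 8≤))
  ... | ()

  weight-⊥ : ∀ {n} (w : Fin n → ℚ) → weight w ⊥ ≡ 0ℚ
  weight-⊥ {zero}  w = refl
  weight-⊥ {suc n} w = trans (ℚ.+-identityˡ _) (weight-⊥ (w ∘ suc))

  weight-⁅⁆ : ∀ {n} (w : Fin n → ℚ) i → weight w ⁅ i ⁆ ≡ w i
  weight-⁅⁆ w zero    = trans (cong (w zero +ℚ_) (weight-⊥ (w ∘ suc))) (ℚ.+-identityʳ (w zero))
  weight-⁅⁆ w (suc i) = trans (ℚ.+-identityˡ _) (weight-⁅⁆ (w ∘ suc) i)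

  -- The game has no rough weights and only long potent certificates.

  module LongGame (m : ℕ) where

    small : Bool → Bool → Bool → Bool → Bool → Subset (5 + m)
    small a b c d e = a ∷ b ∷ c ∷ d ∷ e ∷ ⊥

    -- For a variable `m` the score of the tail `⊥` does not reduce. With the tail removed, `wins`
    -- evaluates on concrete bits and `refl` decides.
    wins-small : ∀ a b c d e → wins (small a b c d e) ≡ wins (a ∷ b ∷ c ∷ d ∷ e ∷ [])
    wins-small a b c d e = cong (λ s → (8 ≤ᵇ 3 * bit a + (3 * bit b + (2 * bit c + (2 * bit d + (2 * bit e + s))))) ∨ (a ∧ b) ∨ (c ∧ d ∧ e))
      (score-⊥ {m} (λ _ → 2))

    game : SimpleGame (5 + m)
    game = record
      { win      = wins
      ; monotone = wins-mono
      ; someWin  = small true true false false false , wins-small true true false false false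
      ; someLose = ⊥ , wins-small false false false false false
      }

    other : Fin m → Subset (5 + m)
    other z = false ∷ false ∷ false ∷ false ∷ false ∷ ⁅ z ⁆

    other-loses : ∀ z → wins (other z) ≡ false
    other-loses z = cong (λ s → (8 ≤ᵇ s) ∨ false) (score-⁅⁆ (λ _ → 2) z)

    -- The losing coalitions {0,2,3} and {1,3,4} together contain every player of the winning {0,1}
    -- and {2,3,4}, and player 3 once more; hence `w 3` is at most 0. Comparing {1,2,4} with {2,3,4}
    -- passes this on to player 1, and similar comparisons reach players 2, 0 and 4. Now {0,1} has
    -- weight 0, so every other player, losing alone, has weight 0 as well, and `q` is squeezed
    -- between the weights of ∅ and {0,1}.
    ¬roughlyWeighted : ¬ RoughlyWeighted game
    ¬roughlyWeighted (w , q , 0≤w , nontrivial , light , heavy) = nontrivial (w≡0 , q≡0)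
      where
      open +-*-Solver
      -- An absent player contributes a literal `0ℚ` to `weight`, which the polynomials have to
      -- reproduce.
      O : ∀ {k} → Polynomial k
      O = con 0ℚ
      q≤win : ∀ X → wins X ≡ true → q ≤ℚ weight w X
      q≤win X p = ℚ.≮⇒≥ (λ X<q → Bool.not-¬ p (light X X<q))
      lose≤q : ∀ X → wins X ≡ false → weight w X ≤ℚ q
      lose≤q X p = ℚ.≮⇒≥ (λ q<X → Bool.not-¬ p (heavy X q<X))
      lose≤win : ∀ X Y → wins X ≡ true → wins Y ≡ false → weight w Y ≤ℚ weight w X
      lose≤win X Y p r = ℚ.≤-trans (lose≤q Y r) (q≤win X p)
      cancel : ∀ {p r s t} k {x y} → p ≤ℚ r → s ≤ℚ t → p +ℚ s ≡ k +ℚ x → r +ℚ t ≡ k +ℚ y → x ≤ℚ y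
      cancel k {x} {y} p≤r s≤t e₁ e₂ = subst₂ _≤ℚ_ (undo x) (undo y)
        (ℚ.+-monoʳ-≤ (-ℚ k) (subst₂ _≤ℚ_ e₁ e₂ (ℚ.+-mono-≤ p≤r s≤t)))
        where
        undo : ∀ x → -ℚ k +ℚ (k +ℚ x) ≡ x
        undo x = trans (sym (ℚ.+-assoc (-ℚ k) k x)) (trans (cong (_+ℚ x) (ℚ.+-inverseˡ k)) (ℚ.+-identityˡ x))
      small-≤ : ∀ a b c d e a′ b′ c′ d′ e′ → wins (a ∷ b ∷ c ∷ d ∷ e ∷ []) ≡ true → wins (a′ ∷ b′ ∷ c′ ∷ d′ ∷ e′ ∷ []) ≡ false →
        weight w (small a′ b′ c′ d′ e′) ≤ℚ weight w (small a b c d e)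
      small-≤ a b c d e a′ b′ c′ d′ e′ p r = lose≤win (small a b c d e) (small a′ b′ c′ d′ e′)
        (trans (wins-small a b c d e) p) (trans (wins-small a′ b′ c′ d′ e′) r)
      a b c d e t : ℚ
      a = w 0F
      b = w 1F
      c = w 2F
      d = w 3F
      e = w 4F
      -- The common tail of the small coalitions; as an opaque variable it simply cancels.
      t = weight (λ i → w (suc (suc (suc (suc (suc i)))))) ⊥
      -- Each step adds two inequalities and cancels the common summand.
      d≤0 : d ≤ℚ 0ℚ
      d≤0 = cancel (a +ℚ (b +ℚ (c +ℚ (d +ℚ (e +ℚ (t +ℚ t)))))) (small-≤ true true false false false true false true true false refl refl) (small-≤ false false true true true false true false true true refl refl)
        (solve 6 (λ a b c d e t → (a :+ (O :+ (c :+ (d :+ (O :+ t))))) :+ (O :+ (b :+ (O :+ (d :+ (e :+ t))))) := (a :+ (b :+ (c :+ (d :+ (e :+ (t :+ t)))))) :+ d) refl a b c d e t)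
        (solve 6 (λ a b c d e t → (a :+ (b :+ (O :+ (O :+ (O :+ t))))) :+ (O :+ (O :+ (c :+ (d :+ (e :+ t))))) := (a :+ (b :+ (c :+ (d :+ (e :+ (t :+ t)))))) :+ O) refl a b c d e t)
      b≤0 : b ≤ℚ 0ℚ
      b≤0 = cancel (c +ℚ (d +ℚ (e +ℚ t))) (small-≤ false false true true true false true true false true refl refl) d≤0
        (solve 6 (λ a b c d e t → (O :+ (b :+ (c :+ (O :+ (e :+ t))))) :+ d := (c :+ (d :+ (e :+ t))) :+ b) refl a b c d e t)
        (solve 6 (λ a b c d e t → (O :+ (O :+ (c :+ (d :+ (e :+ t))))) :+ O := (c :+ (d :+ (e :+ t))) :+ O) refl a b c d e t)
      c≤0 : c ≤ℚ 0ℚ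
      c≤0 = cancel (a +ℚ (b +ℚ (d +ℚ t))) (small-≤ true true false false false true false true true false refl refl) (ℚ.+-mono-≤ b≤0 (0≤w 3F))
        (solve 6 (λ a b c d e t → (a :+ (O :+ (c :+ (d :+ (O :+ t))))) :+ (b :+ O) := (a :+ (b :+ (d :+ t))) :+ c) refl a b c d e t)
        (solve 6 (λ a b c d e t → (a :+ (b :+ (O :+ (O :+ (O :+ t))))) :+ (O :+ d) := (a :+ (b :+ (d :+ t))) :+ O) refl a b c d e t)
      a≤0 : a ≤ℚ 0ℚ
      a≤0 = cancel (c +ℚ (d +ℚ (e +ℚ t))) (small-≤ false false true true true true false false true true refl refl) c≤0
        (solve 6 (λ a b c d e t → (a :+ (O :+ (O :+ (d :+ (e :+ t))))) :+ c := (c :+ (d :+ (e :+ t))) :+ a) refl a b c d e t)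
        (solve 6 (λ a b c d e t → (O :+ (O :+ (c :+ (d :+ (e :+ t))))) :+ O := (c :+ (d :+ (e :+ t))) :+ O) refl a b c d e t)
      e≤0 : e ≤ℚ 0ℚ
      e≤0 = cancel (a +ℚ (b +ℚ (c +ℚ t))) (small-≤ true true false false false true false true false true refl refl) (ℚ.+-mono-≤ b≤0 (0≤w 2F))
        (solve 6 (λ a b c d e t → (a :+ (O :+ (c :+ (O :+ (e :+ t))))) :+ (b :+ O) := (a :+ (b :+ (c :+ t))) :+ e) refl a b c d e t)
        (solve 6 (λ a b c d e t → (a :+ (b :+ (O :+ (O :+ (O :+ t))))) :+ (O :+ c) := (a :+ (b :+ (c :+ t))) :+ O) refl a b c d e t)
      ab≤0 : weight w (small true true false false false) ≤ℚ 0ℚ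
      ab≤0 = subst₂ _≤ℚ_ (solve 3 (λ a b t → (a :+ b) :+ t := a :+ (b :+ (O :+ (O :+ (O :+ t))))) refl a b t)
        (cong (λ z → 0ℚ +ℚ 0ℚ +ℚ z) (weight-⊥ (λ i → w (suc (suc (suc (suc (suc i)))))))) (ℚ.+-monoˡ-≤ t (ℚ.+-mono-≤ a≤0 b≤0))
      w≤0 : ∀ i → w i ≤ℚ 0ℚ
      w≤0 0F = a≤0
      w≤0 1F = b≤0
      w≤0 2F = c≤0
      w≤0 3F = d≤0
      w≤0 4F = e≤0
      w≤0 (suc (suc (suc (suc (suc i))))) = ℚ.≤-trans (subst (_≤ℚ weight w (small true true false false false))
        (weight-⁅⁆ w (suc (suc (suc (suc (suc i)))))) (lose≤win (small true true false false false) (other i) (wins-small true true false false false) (other-loses i))) ab≤0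
      w≡0 : ∀ i → w i ≡ 0ℚ
      w≡0 i = ℚ.≤-antisym (w≤0 i) (0≤w i)
      q≡0 : q ≡ 0ℚ
      q≡0 = ℚ.≤-antisym (ℚ.≤-trans (q≤win (small true true false false false) (wins-small true true false false false)) ab≤0)
        (subst (_≤ℚ q) (weight-⊥ w) (lose≤q ⊥ (wins-small false false false false false)))

    total : sum (points {m}) ≡ 12 + 2 * m
    total = cong (12 +_) (twos m)
      where
      twos : ∀ m → sum {m} (λ _ → 2) ≡ 2 * m
      twos zero    = refl
      twos (suc m) = trans (cong (2 +_) (twos m)) (sym (ℕ.*-suc 2 m))

    -- With n = 5 + m and S the common total, the estimate is 2n + 2 + 6(j - 1) ≤ S ≤ 7(j - 1).
    -- Adding 6 + 7 throughout removes the subtractions, and `6 + 6 * j` is cancelled at the end.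
    long : ∀ j (t : TradingTransform (5 + m) j) → IsPotentCertificate game t → 2 * (5 + m) + 3 ≤ j
    long j t ((xs-win , ys-lose) , (k , xk≡⊤) , (l , yl≡⊥)) = ℕ.+-cancelˡ-≤ (6 + 6 * j) (2 * (5 + m) + 3) j (begin
      6 + 6 * j + (2 * (5 + m) + 3)            ≡⟨ lemma₁ j m ⟩
      12 + 2 * m + 6 * j + 7                   ≡⟨ cong (λ s → s + 6 * j + 7) (trans (cong (score pts) xk≡⊤) (trans (score-⊤ {5 + m} pts) total)) ⟨
      score pts (xs t k) + 6 * j + 7        ≤⟨ ℕ.+-monoˡ-≤ 7 (sum-lower (score pts ∘ xs t) 6 (λ i → wins⇒6≤score (xs t i) (xs-win i)) k) ⟩
      sum (score pts ∘ xs t) + 6 + 7        ≡⟨ cong (λ s → s + 6 + 7) (trans (sum-score pts (xs t)) (trans (sum-cong-≗ (λ i → cong (pts i *_) (balanced t i))) (sym (sum-score pts (ys t))))) ⟩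
      sum (score pts ∘ ys t) + 6 + 7        ≡⟨ lemma₂ (sum (score pts ∘ ys t)) ⟩
      6 + (sum (score pts ∘ ys t) + 7)      ≤⟨ ℕ.+-monoʳ-≤ 6 (sum-upper (score pts ∘ ys t) 7 (λ i → loses⇒score≤7 (ys t i) (ys-lose i)) l) ⟩
      6 + (score pts (ys t l) + 7 * j)      ≡⟨ cong (λ s → 6 + (s + 7 * j)) (trans (cong (score pts) yl≡⊥) (score-⊥ {5 + m} pts)) ⟩
      6 + 7 * j                                ≡⟨ lemma₃ j ⟩
      6 + 6 * j + j                            ∎)
      where
      open ℕ.≤-Reasoning
      pts = points {m}
      lemma₁ : ∀ j m → 6 + 6 * j + (2 * (5 + m) + 3) ≡ 12 + 2 * m + 6 * j + 7
      lemma₁ = ℕ.solve-∀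
      lemma₂ : ∀ s → s + 6 + 7 ≡ 6 + (s + 7)
      lemma₂ = ℕ.solve-∀
      lemma₃ : ∀ j → 6 + 7 * j ≡ 6 + 6 * j + j
      lemma₃ = ℕ.solve-∀

open import Data.Nat using (ℕ; suc; _+_; _*_; _^_; _≤_)

theorem12 : ∀ n → 5 ≤ n →
    (Σ (SimpleGame n) λ G → ¬ RoughlyWeighted G ×
    (∀ j (T : TradingTransform n j) → IsPotentCertificate G T → 2 * n + 3 ≤ j))
    ×
    (∀ (G : SimpleGame n) → ¬ RoughlyWeighted G →
    Σ ℕ λ j → Σ (TradingTransform n j) λ T →
    IsPotentCertificate G T × (j * j ≤ (suc n * suc n) * n ^ n))
theorem12 n 5≤n with ℕ.m≤n⇒∃[o]m+o≡n 5≤n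
... | m , refl = (game , ¬roughlyWeighted , long) , λ G → UpperBound.Certificates.upper-bound G
  where open LowerBound.LongGame m
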